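{- Let $s,y,z$ be indeterminates and define sequences $a_n,b_n,d_n,\alpha_n$ ($n\ge0$) by $$\sum a_nx^n=\frac{(1-yz+z^2)(1-(y^2-2)x+x^2)}{(1-x)(1-(y^2-2)x+x^2)},\quad \sum b_nx^n=\frac{ -z+y(yz-1)x-z(yz-1)x^2}{(1-x)(1-(y^2-2)x+x^2)},$$ $$\sum d_nx^n=\frac{ -1-(1+z^2-2yz)x-z^2x^2}{(1-x)(1-(y^2-2)x+x^2)},\quad \sum\alpha_nx^n=\frac{1+zx}{1+yx+x^2}.$$ For $n\ge0$ let $f_n(x)$ be the formal power series with constant term $1$ satisfying $$(a_nx^4-sb_nx^3+b_nx^2)f_n(x)^2+\big((yd_n-2b_n)x^2-sd_nx+d_n\big)f_n(x)=d_n.$$ Then for every $n\ge0$, $$f_n(x)=\cfrac{1}{1-sx-\cfrac{\frac{\alpha_{n+1}}{\alpha_n}x^2}{1-\cfrac{\frac{\alpha_n}{\alpha_{n+1}}x^2}{1-sx-\cfrac{\frac{\alpha_{n+2}}{\alpha_{n+1}}x^2}{1-\cfrac{\frac{\alpha_{n+1}}{\alpha_{n+2}}x^2}{\ddots}}}}},$$ i.e. the $J$-fraction with $u_{2j+1}=-s$, $u_{2j+2}=0$, $v_0=1$, $v_{2j+1}=\alpha_{n+j+1}/\alpha_{n+j}$, $v_{2j+2}=\alpha_{n+j}/\alpha_{n+j+1}$ ($j\ge0$).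
   Context: All series are formal power series in $x$ with coefficients rational functions of $s,y,z$. A $J$-fraction with sequences $(u_1,u_2,\dots)$, $(v_0,v_1,\dots)$ is $\cfrac{v_0}{1+u_1x-\cfrac{v_1x^2}{1+u_2x-\cdots}}$. -}

module Defs where

open import Data.Nat using (ℕ; zero; suc)
open import Data.Fin using (Fin; toℕ)
open import Data.List using (List; []; _∷_; map)
open import Data.List.Relation.Unary.All using (All; []; _∷_)
import Data.List.Relation.Unary.All as All
open import Data.Vec using (Vec; _∷_; tabulate; zipWith; head)
import Data.Vec as Vec
open import Data.Rational using (ℚ; 0ℚ; 1ℚ)
import Data.Rational as ℚ
open import Data.Product using (_×_)
open import Relation.Binary.PropositionalEquality using (_≡_)
open import Relation.Nullary using (¬_; Dec; yes; no)

-- Polynomials in n variables over ℚ (dense coefficient lists, recursively)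

Poly : ℕ → Set
Poly zero    = ℚ
Poly (suc n) = List (Poly n)

zeroP : ∀ n → Poly n
zeroP zero    = 0ℚ
zeroP (suc n) = []

constP : ∀ n → ℚ → Poly n
constP zero    q = q
constP (suc n) q = constP n q ∷ []

addP : ∀ n → Poly n → Poly n → Poly n
addP zero    p q = p ℚ.+ q
addP (suc n) [] q = q
addP (suc n) (a ∷ p) [] = a ∷ p
addP (suc n) (a ∷ p) (b ∷ q) = addP n a b ∷ addP (suc n) p q

negP : ∀ n → Poly n → Poly n
negP zero    p = ℚ.- p
negP (suc n) p = map (negP n) p

mulP : ∀ n → Poly n → Poly n → Poly n
mulP zero    p q = p ℚ.* q
mulP (suc n) [] q = []
mulP (suc n) (a ∷ p) q = addP (suc n) (map (mulP n a) q) (zeroP n ∷ mulP (suc n) p q)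

IsZeroP : ∀ n → Poly n → Set
IsZeroP zero    p = p ≡ 0ℚ
IsZeroP (suc n) p = All (IsZeroP n) p

isZeroP? : ∀ n → (p : Poly n) → Dec (IsZeroP n p)
isZeroP? zero    p = p ℚ.≟ 0ℚ
isZeroP? (suc n) p = All.all? (isZeroP? n) p

-- Poly 3: outermost variable s, then y, innermost z
P3 : Set
P3 = Poly 3

varS varY varZ : P3
varS = zeroP 2 ∷ constP 2 1ℚ ∷ []
varY = (zeroP 1 ∷ constP 1 1ℚ ∷ []) ∷ []
varZ = ((0ℚ ∷ 1ℚ ∷ []) ∷ []) ∷ []

record K : Set where
  constructor frac
  field
    num : P3
    den : P3
    den≢0 : ¬ IsZeroP 3 den

one≢0 : ¬ IsZeroP 3 (constP 3 1ℚ)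
one≢0 (((() ∷ _) ∷ _) ∷ _)

0K 1K : K
0K = frac (zeroP 3) (constP 3 1ℚ) one≢0
1K = frac (constP 3 1ℚ) (constP 3 1ℚ) one≢0

-- p / q, and 0 if q = 0 (this case never arises for nonzero denominators,
-- since ℚ[s,y,z] is an integral domain; it makes inverse total with 0⁻¹ = 0)
mkK : P3 → P3 → K
mkK p q with isZeroP? 3 q
... | yes _  = 0K
... | no q≢0 = frac p q q≢0

infixl 6 _+K_ _-K_
infixl 7 _*K_ _/K_
infix 4 _≈K_

_+K_ : K → K → K
frac a b _ +K frac c d _ = mkK (addP 3 (mulP 3 a d) (mulP 3 c b)) (mulP 3 b d)

_*K_ : K → K → K
frac a b _ *K frac c d _ = mkK (mulP 3 a c) (mulP 3 b d)

-K_ : K → K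
-K (frac a b p) = frac (negP 3 a) b p

_-K_ : K → K → K
x -K y = x +K (-K y)

invK : K → K
invK (frac a b _) = mkK b a

_/K_ : K → K → K
x /K y = x *K invK y

_≈K_ : K → K → Set
frac a b _ ≈K frac c d _ = IsZeroP 3 (addP 3 (mulP 3 a d) (negP 3 (mulP 3 c b)))

sK yK zK 2K : K
sK = frac varS (constP 3 1ℚ) one≢0
yK = frac varY (constP 3 1ℚ) one≢0
zK = frac varZ (constP 3 1ℚ) one≢0
2K = 1K +K 1K

Series : Set
Series = ℕ → K

infix 4 _≈S_
_≈S_ : Series → Series → Set
f ≈S g = ∀ k → f k ≈K g k

constS : K → Series
constS c zero    = c
constS c (suc k) = 0K

0S 1S xS : Series
0S _ = 0K
1S = constS 1K
xS 1 = 1K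
xS _ = 0K

infixl 6 _+S_ _-S_
infixl 7 _*S_

_+S_ : Series → Series → Series
(f +S g) k = f k +K g k

-S_ : Series → Series
(-S f) k = -K f k

_-S_ : Series → Series → Series
f -S g = f +S (-S g)

sumV : ∀ {n} → Vec K n → K
sumV = Vec.foldr _ _+K_ 0K

_*S_ : Series → Series → Series
(f *S g) k = sumV (tabulate {n = suc k} (λ (i : Fin (suc k)) → f (toℕ i) *K g (k Data.Nat.∸ toℕ i)))

_·S_ : K → Series → Series
(c ·S f) k = c *K f k

-- multiplicative inverse of a series with (nonzero) constant term:
-- g_0 = f_0⁻¹, g_{k+1} = - f_0⁻¹ Σ_{i=0}^{k} f_{i+1} g_{k-i}.
-- invVec f k = g_k ∷ g_{k-1} ∷ … ∷ g_0
invVec : Series → (k : ℕ) → Vec K (suc k)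
invVec f zero    = invK (f 0) ∷ Vec.[]
invVec f (suc k) =
  let v = invVec f k in
  (-K (invK (f 0) *K sumV (zipWith _*K_ (tabulate (λ (i : Fin (suc k)) → f (suc (toℕ i)))) v))) ∷ v

invS : Series → Series
invS f k = head (invVec f k)

infixl 7 _/S_
_/S_ : Series → Series → Series
f /S g = f *S invS g

-- J-fractions  v₀ / (1 + u₁x − v₁x² / (1 + u₂x − v₂x² / …))
-- (u is indexed from 1: the value u 0 is never used.)
-- Tail at level i truncated at depth m:
--   T 0 i = 1,  T (m+1) i = 1 / (1 + u_{i+1} x − v_{i+1} x² T m (i+1)).
-- The J-fraction is the coefficientwise limit of the convergents
-- v₀ · T m 0; the x^k coefficient is stable for m ≥ k, so we take m = k.

JT : (u v : ℕ → K) → ℕ → ℕ → Series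
JT u v zero    i = 1S
JT u v (suc m) i =
  invS (1S +S (u (suc i) ·S xS) -S (v (suc i) ·S (xS *S xS *S JT u v m (suc i))))

JFrac : (u v : ℕ → K) → Series
JFrac u v k = (v 0 ·S JT u v k 0) k

x² x³ x⁴ : Series
x² = xS *S xS
x³ = x² *S xS
x⁴ = x³ *S xS

y²-2 : K
y²-2 = yK *K yK -K 2K

quadS : Series
quadS = 1S -S (y²-2 ·S xS) +S x²

denS : Series
denS = (1S -S xS) *S quadS

aS bS dS αS : Series
aS = ((1K -K yK *K zK +K zK *K zK) ·S quadS) /S denS
bS = ((-K zK) ·S 1S +S ((yK *K (yK *K zK -K 1K)) ·S xS)
       -S ((zK *K (yK *K zK -K 1K)) ·S x²)) /S denS
dS = ((-K 1K) ·S 1S -S ((1K +K zK *K zK -K 2K *K yK *K zK) ·S xS)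
       -S ((zK *K zK) ·S x²)) /S denS
αS = (1S +S (zK ·S xS)) /S (1S +S (yK ·S xS) +S x²)

FEq : ℕ → Series → Set
FEq n f =
  (((aS n ·S x⁴) -S ((sK *K bS n) ·S x³) +S (bS n ·S x²)) *S f *S f
    +S ((((yK *K dS n) -K (2K *K bS n)) ·S x²) -S ((sK *K dS n) ·S xS) +S constS (dS n)) *S f)
  ≈S constS (dS n)

uSeq : ℕ → K
uSeq zero = 0K
uSeq (suc zero) = -K sK
uSeq (suc (suc zero)) = 0K
uSeq (suc (suc (suc j))) = uSeq (suc j)

vSeq' : ℕ → ℕ → K
vSeq' n zero = αS (suc n) /K αS n
vSeq' n (suc zero) = αS n /K αS (suc n)
vSeq' n (suc (suc j)) = vSeq' (suc n) j

vSeq : ℕ → ℕ → K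
vSeq n zero    = 1K
vSeq n (suc i) = vSeq' n i

{-# OPTIONS --safe #-}

-- Put α_{-1} = -z, so that α_{n+1} = -y α_n - α_{n-1} for all n ≥ 0. Comparing
-- generating functions, with p = α_{n-1}, q = α_n and r = α_{n+1},
-- a_n = q² + y p q + p² (which is constant in n), b_n = p q and d_n = -q². Let R_n(f)
-- be the difference of the two sides of the equation of f_n. If f arises from F by
-- two levels of the J-fraction, then f = q W / D with W = r - q x² F and
-- D = q (1 - s x) W - r² x², and R_n(f) D² = q⁴ x⁴ R_{n+1}(F), where D is a unit.
-- Hence R_n of the m-th convergent vanishes to an order which grows with m.
-- On the other hand, R_n(f) - R_n(g) is f - g times a series with constant
-- term -q², so that R_n(f) and R_n(g) being close forces f and g to be close: the
-- convergents tend to a root, and the root is unique. All α_n are nonzero, because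
-- they take the value 1 at s = 0, y = -2, z = -1.

module Submission where

open import Defs
open import Algebra.Bundles using (CommutativeRing; RawRing)
import Algebra.Morphism.RingMonomorphism
import Algebra.Solver.Ring.AlmostCommutativeRing as ACR
open import Algebra.Structures using (IsCommutativeRing)
open import Data.Empty using (⊥-elim)
open import Data.Fin using (Fin; toℕ)
import Data.Fin as Fin
open import Data.Integer as ℤ using (ℤ; +_; -[1+_])
import Data.Integer.Properties as ℤ
open import Data.List using ([]; _∷_; map)
open import Data.List.Relation.Unary.All using ([]; _∷_)
open import Data.Maybe using (Maybe; just; nothing)
open import Data.Nat using (ℕ; zero; suc; _<_; _≤_; z≤n; s≤s)
import Data.Nat as ℕ
import Data.Nat.Properties as ℕ
open import Data.Product using (_×_; _,_; proj₁; proj₂)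
open import Data.Rational using (ℚ; 0ℚ; 1ℚ)
import Data.Rational as ℚ
import Data.Rational.Properties as ℚ
open import Data.Sum using (_⊎_; inj₁; inj₂)
import Data.Sum as Sum
open import Data.Vec using (_∷_; tabulate; zipWith)
open import Function using (_∘_; id)
open import Level using (_⊔_)
open import Relation.Binary.PropositionalEquality using (_≡_)
import Relation.Binary.PropositionalEquality as ≡
import Relation.Binary.Reasoning.Setoid
open import Relation.Nullary using (¬_; yes; no)

-- A ring solver with integer coefficients

-- The quotient q W / D is the two-level fraction with its denominators cleared: g = 1 / (1 - (q/r)
-- x² F) is r / W, and then 1 / (1 - s x - (r/q) x² g) is q W / D. Two levels are the natural unit,
-- because the entries u have period two and those of v come back with n replaced by n + 1; the
-- truncations with 0 and with 1 level are therefore both base cases. The relation between R_n and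
-- R_{n+1} says that the Möbius map taking F to q W / D pulls one quadratic form back to a multiple
-- of the next. The k-th coefficient of the J-fraction is read off the k-th convergent, so that the
-- passage to the limit asks for order m + 1 at the m-th convergent.
--
-- The remaining work lies in the coefficients. Polynomials are lists up to trailing zeros and
-- fractions are not reduced, so the ring laws hold only up to an equivalence, and cancelling
-- denominators requires that ℚ[s,y,z] has no zero divisors. Each layer is proved over abstract
-- operations specified by equations and is instantiated afterwards.

module IntegerCoefficientSolver {c ℓ} (R : CommutativeRing c ℓ) where
  open CommutativeRing R
  open import Algebra.Properties.Ring ring
  open import Algebra.Properties.Monoid.Mult.TCOptimised +-monoid using (×-homo-+; 1+×) renaming (_×_ to _×′_)
  open import Algebra.Properties.Semiring.Mult.TCOptimised semiring using (×1-homo-*)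
  open import Relation.Binary.Reasoning.Setoid setoid

  -- With this form of multiples, `con (+ 0)`, `con (+ 1)` and `con (+ 2)` denote `0#`, `1#` and
  -- `1# + 1#` definitionally, so that solved equations match statements written with these
  -- constants.
  fromℤ : ℤ → Carrier
  fromℤ (+ n)    = n ×′ 1#
  fromℤ -[1+ n ] = - (suc n ×′ 1#)

  fromℤ-⊖ : ∀ m n → fromℤ (m ℤ.⊖ n) ≈ m ×′ 1# - n ×′ 1#
  fromℤ-⊖ m zero = begin
    m ×′ 1#         ≈⟨ +-identityʳ _ ⟨
    m ×′ 1# + 0#    ≈⟨ +-congˡ -0#≈0# ⟨
    m ×′ 1# - 0#    ∎
  fromℤ-⊖ zero (suc n) = sym (+-identityˡ _)
  fromℤ-⊖ (suc m) (suc n) = begin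
    fromℤ (suc m ℤ.⊖ suc n)               ≡⟨ ≡.cong fromℤ (ℤ.[1+m]⊖[1+n]≡m⊖n m n) ⟩
    fromℤ (m ℤ.⊖ n)                       ≈⟨ fromℤ-⊖ m n ⟩
    m ×′ 1# - n ×′ 1#                       ≈⟨ +-congʳ (xyx⁻¹≈y 1# (m ×′ 1#)) ⟨
    1# + m ×′ 1# - 1# - n ×′ 1#             ≈⟨ +-assoc _ _ _ ⟩
    1# + m ×′ 1# + (- 1# - n ×′ 1#)         ≈⟨ +-cong (sym (1+× m 1#)) (trans (-‿+-comm _ _) (-‿cong (sym (1+× n 1#)))) ⟩
    suc m ×′ 1# - suc n ×′ 1#               ∎

  fromℤ-neg : ∀ i → fromℤ (ℤ.- i) ≈ - fromℤ i
  fromℤ-neg (+ zero)  = sym -0#≈0#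
  fromℤ-neg (+ suc n) = refl
  fromℤ-neg -[1+ n ]  = sym (-‿involutive _)

  fromℤ-+ : ∀ i j → fromℤ (i ℤ.+ j) ≈ fromℤ i + fromℤ j
  fromℤ-+ (+ m)    (+ n)    = ×-homo-+ 1# m n
  fromℤ-+ (+ m)    -[1+ n ] = fromℤ-⊖ m (suc n)
  fromℤ-+ -[1+ m ] (+ n)    = trans (fromℤ-⊖ n (suc m)) (+-comm _ _)
  fromℤ-+ -[1+ m ] -[1+ n ] = begin
    - (suc (suc (m ℕ.+ n)) ×′ 1#)        ≡⟨ ≡.cong (λ k → - (k ×′ 1#)) (≡.cong suc (ℕ.+-suc m n)) ⟨
    - ((suc m ℕ.+ suc n) ×′ 1#)          ≈⟨ -‿cong (×-homo-+ 1# (suc m) (suc n)) ⟩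
    - (suc m ×′ 1# + suc n ×′ 1#)         ≈⟨ -‿+-comm _ _ ⟨
    - (suc m ×′ 1#) - suc n ×′ 1#         ∎

  fromℤ-pos* : ∀ m j → fromℤ (+ m ℤ.* j) ≈ m ×′ 1# * fromℤ j
  fromℤ-pos* m (+ n) = trans (reflexive (≡.cong fromℤ (≡.sym (ℤ.pos-* m n)))) (×1-homo-* m n)
  fromℤ-pos* m -[1+ n ] = begin
    fromℤ (+ m ℤ.* -[1+ n ])            ≡⟨ ≡.cong fromℤ (ℤ.neg-distribʳ-* (+ m) (+ suc n)) ⟨
    fromℤ (ℤ.- (+ m ℤ.* + suc n))       ≈⟨ fromℤ-neg (+ m ℤ.* + suc n) ⟩
    - fromℤ (+ m ℤ.* + suc n)           ≈⟨ -‿cong (fromℤ-pos* m (+ suc n)) ⟩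
    - (m ×′ 1# * (suc n ×′ 1#))           ≈⟨ -‿distribʳ-* _ _ ⟩
    m ×′ 1# * - (suc n ×′ 1#)             ∎

  fromℤ-* : ∀ i j → fromℤ (i ℤ.* j) ≈ fromℤ i * fromℤ j
  fromℤ-* (+ m) j = fromℤ-pos* m j
  fromℤ-* -[1+ m ] j = begin
    fromℤ (-[1+ m ] ℤ.* j)              ≡⟨ ≡.cong fromℤ (ℤ.neg-distribˡ-* (+ suc m) j) ⟨
    fromℤ (ℤ.- (+ suc m ℤ.* j))         ≈⟨ fromℤ-neg (+ suc m ℤ.* j) ⟩
    - fromℤ (+ suc m ℤ.* j)             ≈⟨ -‿cong (fromℤ-pos* (suc m) j) ⟩
    - (suc m ×′ 1# * fromℤ j)            ≈⟨ -‿distribˡ-* _ _ ⟩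
    - (suc m ×′ 1#) * fromℤ j            ∎

  morphism : ℤ.+-*-rawRing ACR.-Raw-AlmostCommutative⟶ ACR.fromCommutativeRing R
  morphism = record
    { ⟦_⟧ = fromℤ ; +-homo = fromℤ-+ ; *-homo = fromℤ-* ; -‿homo = fromℤ-neg
    ; 0-homo = refl ; 1-homo = refl }

  -- Comparing the integers themselves is sound in every ring and asks for no decidable equality on
  -- `Carrier`; distinct integers that coincide in the ring are simply not identified.
  fromℤ≟ : ∀ i j → Maybe (fromℤ i ≈ fromℤ j)
  fromℤ≟ i j with i ℤ.≟ j
  ... | yes i≡j = just (reflexive (≡.cong fromℤ i≡j))
  ... | no _    = nothing

  open import Algebra.Solver.Ring ℤ.+-*-rawRing (ACR.fromCommutativeRing R) morphism fromℤ≟ public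
    using (solve; _:=_; _:+_; _:*_; _:-_; :-_; con)

-- Formal power series

-- An interface, because it is used both for the coefficients of polynomials, where the product is
-- `conv`, and for the product `_*S_` of the statement. Peeling off the constant term of the left
-- factor determines the product, and the ring laws follow by induction on the index.
record SeriesOperations {c ℓ} (R : CommutativeRing c ℓ) : Set (c ⊔ ℓ) where
  open CommutativeRing R
  infixl 7 _⊛_
  field
    _⊛_       : (ℕ → Carrier) → (ℕ → Carrier) → (ℕ → Carrier)
    ⊛-zero    : ∀ f g → (f ⊛ g) 0 ≈ f 0 * g 0
    ⊛-suc     : ∀ f g k → (f ⊛ g) (suc k) ≈ f 0 * g (suc k) + ((f ∘ suc) ⊛ g) k
    const     : Carrier → ℕ → Carrier
    const-zero : ∀ c → const c 0 ≈ c
    const-suc  : ∀ c k → const c (suc k) ≈ 0#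
    X          : ℕ → Carrier
    X-zero     : X 0 ≈ 0#
    X-one      : X 1 ≈ 1#
    X-suc      : ∀ k → X (suc (suc k)) ≈ 0#

module PowerSeries {c ℓ} {R : CommutativeRing c ℓ} (O : SeriesOperations R) where
  open CommutativeRing R
  open SeriesOperations O
  open IntegerCoefficientSolver R
  open import Relation.Binary.Reasoning.Setoid setoid

  infix 4 _≋_
  _≋_ : (ℕ → Carrier) → (ℕ → Carrier) → Set ℓ
  f ≋ g = ∀ k → f k ≈ g k

  infixl 6 _⊕_
  _⊕_ : (ℕ → Carrier) → (ℕ → Carrier) → (ℕ → Carrier)
  (f ⊕ g) k = f k + g k

  ⊛-cong : ∀ {f f′ g g′} → f ≋ f′ → g ≋ g′ → f ⊛ g ≋ f′ ⊛ g′
  ⊛-cong {f} {f′} {g} {g′} p q zero = begin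
    (f ⊛ g) 0     ≈⟨ ⊛-zero f g ⟩
    f 0 * g 0     ≈⟨ *-cong (p 0) (q 0) ⟩
    f′ 0 * g′ 0   ≈⟨ ⊛-zero f′ g′ ⟨
    (f′ ⊛ g′) 0   ∎
  ⊛-cong {f} {f′} {g} {g′} p q (suc k) = begin
    (f ⊛ g) (suc k)                              ≈⟨ ⊛-suc f g k ⟩
    f 0 * g (suc k) + ((f ∘ suc) ⊛ g) k          ≈⟨ +-cong (*-cong (p 0) (q (suc k))) (⊛-cong (p ∘ suc) q k) ⟩
    f′ 0 * g′ (suc k) + ((f′ ∘ suc) ⊛ g′) k      ≈⟨ ⊛-suc f′ g′ k ⟨
    (f′ ⊛ g′) (suc k)                            ∎

  ⊛-distribʳ : ∀ h f g → (f ⊕ g) ⊛ h ≋ f ⊛ h ⊕ g ⊛ h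
  ⊛-distribʳ h f g zero = begin
    ((f ⊕ g) ⊛ h) 0             ≈⟨ ⊛-zero (f ⊕ g) h ⟩
    (f 0 + g 0) * h 0           ≈⟨ distribʳ (h 0) (f 0) (g 0) ⟩
    f 0 * h 0 + g 0 * h 0       ≈⟨ +-cong (⊛-zero f h) (⊛-zero g h) ⟨
    (f ⊛ h ⊕ g ⊛ h) 0           ∎
  ⊛-distribʳ h f g (suc k) = begin
    ((f ⊕ g) ⊛ h) (suc k)
      ≈⟨ ⊛-suc (f ⊕ g) h k ⟩
    (f 0 + g 0) * h (suc k) + ((f ∘ suc ⊕ g ∘ suc) ⊛ h) k
      ≈⟨ +-congˡ (⊛-distribʳ h (f ∘ suc) (g ∘ suc) k) ⟩
    (f 0 + g 0) * h (suc k) + (((f ∘ suc) ⊛ h) k + ((g ∘ suc) ⊛ h) k)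
      ≈⟨ solve 5 (λ a b c d e → (a :+ b) :* c :+ (d :+ e) := (a :* c :+ d) :+ (b :* c :+ e)) refl _ _ _ _ _ ⟩
    (f 0 * h (suc k) + ((f ∘ suc) ⊛ h) k) + (g 0 * h (suc k) + ((g ∘ suc) ⊛ h) k)
      ≈⟨ +-cong (⊛-suc f h k) (⊛-suc g h k) ⟨
    (f ⊛ h ⊕ g ⊛ h) (suc k) ∎

  scale-⊛ : ∀ c f g → (λ k → c * f k) ⊛ g ≋ (λ k → c * (f ⊛ g) k)
  scale-⊛ c f g zero = begin
    ((λ k → c * f k) ⊛ g) 0     ≈⟨ ⊛-zero (λ k → c * f k) g ⟩
    c * f 0 * g 0               ≈⟨ *-assoc c (f 0) (g 0) ⟩
    c * (f 0 * g 0)             ≈⟨ *-congˡ (⊛-zero f g) ⟨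
    c * (f ⊛ g) 0               ∎
  scale-⊛ c f g (suc k) = begin
    ((λ j → c * f j) ⊛ g) (suc k)
      ≈⟨ ⊛-suc (λ j → c * f j) g k ⟩
    c * f 0 * g (suc k) + ((λ j → c * f (suc j)) ⊛ g) k
      ≈⟨ +-cong (*-assoc c _ _) (scale-⊛ c (f ∘ suc) g k) ⟩
    c * (f 0 * g (suc k)) + c * ((f ∘ suc) ⊛ g) k
      ≈⟨ distribˡ c _ _ ⟨
    c * (f 0 * g (suc k) + ((f ∘ suc) ⊛ g) k)
      ≈⟨ *-congˡ (⊛-suc f g k) ⟨
    c * (f ⊛ g) (suc k) ∎

  ⊛-zeroˡ : ∀ {f} → f ≋ (λ _ → 0#) → ∀ g → f ⊛ g ≋ (λ _ → 0#)
  ⊛-zeroˡ {f} f≋0 g k = begin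
    (f ⊛ g) k                      ≈⟨ ⊛-cong (λ j → trans (f≋0 j) (sym (zeroˡ (f j)))) (λ _ → refl) k ⟩
    ((λ j → 0# * f j) ⊛ g) k       ≈⟨ scale-⊛ 0# f g k ⟩
    0# * (f ⊛ g) k                 ≈⟨ zeroˡ _ ⟩
    0#                             ∎

  -- The mirror image of `⊛-suc`. Commutativity amounts to comparing the two recursions, and the
  -- absence of zero divisors also rests on peeling the right factor.
  ⊛-sucʳ : ∀ f g k → (f ⊛ g) (suc k) ≈ (f ⊛ (g ∘ suc)) k + f (suc k) * g 0
  ⊛-sucʳ f g zero = begin
    (f ⊛ g) 1                             ≈⟨ ⊛-suc f g 0 ⟩
    f 0 * g 1 + ((f ∘ suc) ⊛ g) 0         ≈⟨ +-cong (sym (⊛-zero f (g ∘ suc))) (⊛-zero (f ∘ suc) g) ⟩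
    (f ⊛ (g ∘ suc)) 0 + f 1 * g 0         ∎
  ⊛-sucʳ f g (suc k) = begin
    (f ⊛ g) (suc (suc k))
      ≈⟨ ⊛-suc f g (suc k) ⟩
    f 0 * g (suc (suc k)) + ((f ∘ suc) ⊛ g) (suc k)
      ≈⟨ +-congˡ (⊛-sucʳ (f ∘ suc) g k) ⟩
    f 0 * g (suc (suc k)) + (((f ∘ suc) ⊛ (g ∘ suc)) k + f (suc (suc k)) * g 0)
      ≈⟨ +-assoc _ _ _ ⟨
    f 0 * g (suc (suc k)) + ((f ∘ suc) ⊛ (g ∘ suc)) k + f (suc (suc k)) * g 0
      ≈⟨ +-congʳ (⊛-suc f (g ∘ suc) k) ⟨
    (f ⊛ (g ∘ suc)) (suc k) + f (suc (suc k)) * g 0 ∎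

  ⊛-comm : ∀ f g → f ⊛ g ≋ g ⊛ f
  ⊛-comm f g zero = begin
    (f ⊛ g) 0   ≈⟨ ⊛-zero f g ⟩
    f 0 * g 0   ≈⟨ *-comm (f 0) (g 0) ⟩
    g 0 * f 0   ≈⟨ ⊛-zero g f ⟨
    (g ⊛ f) 0   ∎
  ⊛-comm f g (suc k) = begin
    (f ⊛ g) (suc k)                              ≈⟨ ⊛-suc f g k ⟩
    f 0 * g (suc k) + ((f ∘ suc) ⊛ g) k          ≈⟨ +-cong (*-comm _ _) (⊛-comm (f ∘ suc) g k) ⟩
    g (suc k) * f 0 + (g ⊛ (f ∘ suc)) k          ≈⟨ +-comm _ _ ⟩
    (g ⊛ (f ∘ suc)) k + g (suc k) * f 0          ≈⟨ ⊛-sucʳ g f k ⟨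
    (g ⊛ f) (suc k)                              ∎

  ⊛-assoc : ∀ f g h → (f ⊛ g) ⊛ h ≋ f ⊛ (g ⊛ h)
  ⊛-assoc f g h zero = begin
    ((f ⊛ g) ⊛ h) 0      ≈⟨ trans (⊛-zero (f ⊛ g) h) (*-congʳ (⊛-zero f g)) ⟩
    f 0 * g 0 * h 0      ≈⟨ *-assoc _ _ _ ⟩
    f 0 * (g 0 * h 0)    ≈⟨ trans (⊛-zero f (g ⊛ h)) (*-congˡ (⊛-zero g h)) ⟨
    (f ⊛ (g ⊛ h)) 0      ∎
  ⊛-assoc f g h (suc k) = begin
    ((f ⊛ g) ⊛ h) (suc k)
      ≈⟨ ⊛-suc (f ⊛ g) h k ⟩
    (f ⊛ g) 0 * h (suc k) + (((f ⊛ g) ∘ suc) ⊛ h) k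
      ≈⟨ +-cong (*-congʳ (⊛-zero f g)) (⊛-cong (⊛-suc f g) (λ _ → refl) k) ⟩
    f 0 * g 0 * h (suc k) + (((λ j → f 0 * g (suc j)) ⊕ (f ∘ suc) ⊛ g) ⊛ h) k
      ≈⟨ +-congˡ (⊛-distribʳ h (λ j → f 0 * g (suc j)) ((f ∘ suc) ⊛ g) k) ⟩
    f 0 * g 0 * h (suc k) + (((λ j → f 0 * g (suc j)) ⊛ h) k + (((f ∘ suc) ⊛ g) ⊛ h) k)
      ≈⟨ +-congˡ (+-cong (scale-⊛ (f 0) (g ∘ suc) h k) (⊛-assoc (f ∘ suc) g h k)) ⟩
    f 0 * g 0 * h (suc k) + (f 0 * ((g ∘ suc) ⊛ h) k + ((f ∘ suc) ⊛ (g ⊛ h)) k)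
      ≈⟨ solve 5 (λ a b c d e → a :* b :* c :+ (a :* d :+ e) := a :* (b :* c :+ d) :+ e) refl _ _ _ _ _ ⟩
    f 0 * (g 0 * h (suc k) + ((g ∘ suc) ⊛ h) k) + ((f ∘ suc) ⊛ (g ⊛ h)) k
      ≈⟨ +-congʳ (*-congˡ (⊛-suc g h k)) ⟨
    f 0 * (g ⊛ h) (suc k) + ((f ∘ suc) ⊛ (g ⊛ h)) k
      ≈⟨ ⊛-suc f (g ⊛ h) k ⟨
    (f ⊛ (g ⊛ h)) (suc k) ∎

  const-⊛ : ∀ c f → const c ⊛ f ≋ (λ k → c * f k)
  const-⊛ c f zero = trans (⊛-zero (const c) f) (*-congʳ (const-zero c))
  const-⊛ c f (suc k) = begin
    (const c ⊛ f) (suc k)                                   ≈⟨ ⊛-suc (const c) f k ⟩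
    const c 0 * f (suc k) + ((const c ∘ suc) ⊛ f) k         ≈⟨ +-cong (*-congʳ (const-zero c)) (⊛-zeroˡ (const-suc c) f k) ⟩
    c * f (suc k) + 0#                                      ≈⟨ +-identityʳ _ ⟩
    c * f (suc k)                                           ∎

  ⊛-identityˡ : ∀ f → const 1# ⊛ f ≋ f
  ⊛-identityˡ f k = trans (const-⊛ 1# f k) (*-identityˡ (f k))

  ⊛-isCommutativeRing : IsCommutativeRing _≋_ _⊕_ _⊛_ (λ f k → - f k) (λ _ → 0#) (const 1#)
  ⊛-isCommutativeRing = record
    { isRing = record
      { +-isAbelianGroup = record
        { isGroup = record
          { isMonoid = record
            { isSemigroup = record
              { isMagma = record
                { isEquivalence = record
                  { refl = λ _ → refl ; sym = λ p k → sym (p k) ; trans = λ p q k → trans (p k) (q k) }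
                ; ∙-cong = λ p q k → +-cong (p k) (q k) }
              ; assoc = λ f g h k → +-assoc (f k) (g k) (h k) }
            ; identity = (λ f k → +-identityˡ (f k)) , (λ f k → +-identityʳ (f k)) }
          ; inverse = (λ f k → -‿inverseˡ (f k)) , (λ f k → -‿inverseʳ (f k))
          ; ⁻¹-cong = λ p k → -‿cong (p k) }
        ; comm = λ f g k → +-comm (f k) (g k) }
      ; *-cong = ⊛-cong
      ; *-assoc = ⊛-assoc
      ; *-identity = ⊛-identityˡ , λ f k → trans (⊛-comm f (const 1#) k) (⊛-identityˡ f k)
      ; distrib = (λ h f g k → trans (⊛-comm h (f ⊕ g) k) (trans (⊛-distribʳ h f g k) (+-cong (⊛-comm f h k) (⊛-comm g h k))))
                , ⊛-distribʳ }
    ; *-comm = ⊛-comm }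

  seriesRing : CommutativeRing c ℓ
  seriesRing = record { isCommutativeRing = ⊛-isCommutativeRing }

-- The polynomial rings

module Convolution {c ℓ} (R : CommutativeRing c ℓ) where
  open CommutativeRing R

  conv : (ℕ → Carrier) → (ℕ → Carrier) → (ℕ → Carrier)
  conv f g zero    = f 0 * g 0
  conv f g (suc k) = f 0 * g (suc k) + conv (f ∘ suc) g k

  constant : Carrier → ℕ → Carrier
  constant c zero    = c
  constant c (suc k) = 0#

  indeterminate : ℕ → Carrier
  indeterminate 1 = 1#
  indeterminate _ = 0#

  convolution : SeriesOperations R
  convolution = record
    { _⊛_ = conv ; ⊛-zero = λ _ _ → refl ; ⊛-suc = λ _ _ _ → refl
    ; const = constant ; const-zero = λ _ → refl ; const-suc = λ _ _ → refl
    ; X = indeterminate ; X-zero = refl ; X-one = refl ; X-suc = λ _ → refl }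

-- Lists that differ by trailing zeros stand for the same polynomial. The form chosen makes `_≈K_`
-- literally `EqP 3` of the cross products.
EqP : ∀ n → Poly n → Poly n → Set
EqP n p q = IsZeroP n (addP n p (negP n q))

coeff : ∀ {n} → Poly (suc n) → ℕ → Poly n
coeff {n} []      _       = zeroP n
coeff     (a ∷ p) zero    = a
coeff     (a ∷ p) (suc k) = coeff p k

IsZeroP⇒EqP : ∀ n {p} → IsZeroP n p → EqP n p (zeroP n)
IsZeroP⇒EqP zero    {p} p≡0 = ≡.trans (ℚ.+-identityʳ p) p≡0
IsZeroP⇒EqP (suc n) {[]} [] = []
IsZeroP⇒EqP (suc n) {_ ∷ _} 0p = 0p

EqP⇒IsZeroP : ∀ n {p} → EqP n p (zeroP n) → IsZeroP n p
EqP⇒IsZeroP zero    {p} p≡0 = ≡.trans (≡.sym (ℚ.+-identityʳ p)) p≡0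
EqP⇒IsZeroP (suc n) {[]} [] = []
EqP⇒IsZeroP (suc n) {_ ∷ _} 0p = 0p

module RationalPolynomials where
  open CommutativeRing ℚ.+-*-commutativeRing hiding (isCommutativeRing)
  open import Algebra.Properties.Ring ring using (x∙y⁻¹≈ε⇒x≈y; x≈y⇒x∙y⁻¹≈ε)
  open import Algebra.Morphism.Structures using (module RingMorphisms)

  -- Even for constants the equality is `p - q ≡ 0ℚ` and not `p ≡ q`, so the laws of ℚ are
  -- transported along the identity map.
  isCommutativeRing : IsCommutativeRing (EqP 0) (addP 0) (mulP 0) (negP 0) (zeroP 0) (constP 0 1ℚ)
  isCommutativeRing = Transport.isCommutativeRing ℚ.+-*-isCommutativeRing
    where
    raw : RawRing _ _
    raw = record { _≈_ = EqP 0 ; _+_ = addP 0 ; _*_ = mulP 0 ; -_ = negP 0 ; 0# = 0ℚ ; 1# = 1ℚ }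
    open RingMorphisms raw (CommutativeRing.rawRing ℚ.+-*-commutativeRing)
    idMono : IsRingMonomorphism id
    idMono = record
      { isRingHomomorphism = record
        { isSemiringHomomorphism = record
          { isNearSemiringHomomorphism = record
            { +-isMonoidHomomorphism = record
              { isMagmaHomomorphism = record
                { isRelHomomorphism = record { cong = λ {p} {q} → x∙y⁻¹≈ε⇒x≈y p q }
                ; homo = λ _ _ → ≡.refl }
              ; ε-homo = ≡.refl }
            ; *-homo = λ _ _ → ≡.refl }
          ; 1#-homo = ≡.refl }
        ; -‿homo = λ _ → ≡.refl }
      ; injective = x≈y⇒x∙y⁻¹≈ε }
    module Transport = Algebra.Morphism.RingMonomorphism idMono

module PolynomialExtension (n : ℕ)
  (isCR : IsCommutativeRing (EqP n) (addP n) (mulP n) (negP n) (zeroP n) (constP n 1ℚ)) where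

  R : CommutativeRing _ _
  R = record { isCommutativeRing = isCR }
  open CommutativeRing R hiding (isCommutativeRing)
  open Convolution R
  open PowerSeries convolution
  open import Algebra.Properties.Ring ring using (x∙y⁻¹≈ε⇒x≈y; x≈y⇒x∙y⁻¹≈ε; -0#≈0#)
  open import Algebra.Morphism.Structures using (module RingMorphisms)

  isZero-coeff : ∀ {p} → IsZeroP (suc n) p → ∀ k → coeff p k ≈ 0#
  isZero-coeff []       k       = refl
  isZero-coeff (0a ∷ _)  zero    = IsZeroP⇒EqP n 0a
  isZero-coeff (_  ∷ 0p) (suc k) = isZero-coeff 0p k

  coeff-isZero : ∀ {p} → (∀ k → coeff p k ≈ 0#) → IsZeroP (suc n) p
  coeff-isZero {[]}    h = []
  coeff-isZero {_ ∷ _} h = EqP⇒IsZeroP n (h 0) ∷ coeff-isZero (h ∘ suc)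

  coeff-+ : ∀ p q k → coeff (addP (suc n) p q) k ≈ coeff p k + coeff q k
  coeff-+ []      q       k       = sym (+-identityˡ _)
  coeff-+ (_ ∷ _) []      k       = sym (+-identityʳ _)
  coeff-+ (_ ∷ _) (_ ∷ _) zero    = refl
  coeff-+ (_ ∷ p) (_ ∷ q) (suc k) = coeff-+ p q k

  coeff-neg : ∀ p k → coeff (negP (suc n) p) k ≈ - coeff p k
  coeff-neg []      k       = sym -0#≈0#
  coeff-neg (_ ∷ _) zero    = refl
  coeff-neg (_ ∷ p) (suc k) = coeff-neg p k

  coeff-scale : ∀ a p k → coeff (map (mulP n a) p) k ≈ a * coeff p k
  coeff-scale a []      k       = sym (zeroʳ a)
  coeff-scale a (_ ∷ _) zero    = refl
  coeff-scale a (_ ∷ p) (suc k) = coeff-scale a p k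

  coeff-* : ∀ p q → coeff (mulP (suc n) p q) ≋ conv (coeff p) (coeff q)
  coeff-* []      q k       = sym (⊛-zeroˡ (λ _ → refl) (coeff q) k)
  coeff-* (a ∷ p) q zero    = trans (coeff-+ (map (mulP n a) q) _ 0)
    (trans (+-identityʳ _) (coeff-scale a q 0))
  coeff-* (a ∷ p) q (suc k) = trans (coeff-+ (map (mulP n a) q) _ (suc k))
    (+-cong (coeff-scale a q (suc k)) (coeff-* p q k))

  coeff-1 : coeff (constP (suc n) 1ℚ) ≋ constant 1#
  coeff-1 zero    = refl
  coeff-1 (suc _) = refl

  -- `coeff` embeds lists modulo trailing zeros into power series and respects all operations, so
  -- the laws are pulled back from the ring of series.
  isCommutativeRing : IsCommutativeRing (EqP (suc n)) (addP (suc n)) (mulP (suc n)) (negP (suc n))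
    (zeroP (suc n)) (constP (suc n) 1ℚ)
  isCommutativeRing = Transport.isCommutativeRing ⊛-isCommutativeRing
    where
    raw : RawRing _ _
    raw = record
      { _≈_ = EqP (suc n) ; _+_ = addP (suc n) ; _*_ = mulP (suc n) ; -_ = negP (suc n)
      ; 0# = zeroP (suc n) ; 1# = constP (suc n) 1ℚ }
    open RingMorphisms raw (CommutativeRing.rawRing seriesRing)
    difference : ∀ p q k → coeff (addP (suc n) p (negP (suc n) q)) k ≈ coeff p k - coeff q k
    difference p q k = trans (coeff-+ p (negP (suc n) q) k) (+-congˡ (coeff-neg q k))
    coeffMono : IsRingMonomorphism coeff
    coeffMono = record
      { isRingHomomorphism = record
        { isSemiringHomomorphism = record
          { isNearSemiringHomomorphism = record
            { +-isMonoidHomomorphism = record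
              { isMagmaHomomorphism = record
                { isRelHomomorphism = record
                  { cong = λ {p} {q} p≈q k → x∙y⁻¹≈ε⇒x≈y _ _ (trans (sym (difference p q k)) (isZero-coeff p≈q k)) }
                ; homo = coeff-+ }
              ; ε-homo = λ _ → refl }
            ; *-homo = coeff-* }
          ; 1#-homo = coeff-1 }
        ; -‿homo = coeff-neg }
      ; injective = λ {p} {q} p≋q → coeff-isZero (λ k → trans (difference p q k) (x≈y⇒x∙y⁻¹≈ε (p≋q k))) }
    module Transport = Algebra.Morphism.RingMonomorphism coeffMono

  module _ (noZeroDivisors : ∀ p q → IsZeroP n (mulP n p q) → IsZeroP n p ⊎ IsZeroP n q) where

    -- The lowest coefficient of the product is `a` times the head of `q`, so this head vanishes;
    -- removing it shifts the product by one place, and the induction goes on.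
    head≢0⇒isZero : ∀ {a} p q → ¬ IsZeroP n a → (∀ k → conv (coeff (a ∷ p)) (coeff q) k ≈ 0#) → IsZeroP (suc n) q
    head≢0⇒isZero p []      a≢0 h = []
    head≢0⇒isZero {a} p (b ∷ q) a≢0 h = 0b ∷ head≢0⇒isZero p q a≢0 (λ k →
      trans (sym (trans (+-congˡ (trans (*-congˡ (IsZeroP⇒EqP n 0b)) (zeroʳ _))) (+-identityʳ _)))
            (trans (sym (⊛-sucʳ (coeff (a ∷ p)) (coeff (b ∷ q)) k)) (h (suc k))))
      where
      0b : IsZeroP n b
      0b with noZeroDivisors a b (EqP⇒IsZeroP n (h 0))
      ... | inj₁ 0a = ⊥-elim (a≢0 0a)
      ... | inj₂ 0b = 0b

    -- Strips the zero coefficients at the low end of `p`. Lowest terms serve here in place of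
    -- leading ones, since trailing zeros hide the degree.
    conv-noZeroDivisors : ∀ p q → (∀ k → conv (coeff p) (coeff q) k ≈ 0#) → IsZeroP (suc n) p ⊎ IsZeroP (suc n) q
    conv-noZeroDivisors []      q h = inj₁ []
    conv-noZeroDivisors (a ∷ p) q h with isZeroP? n a
    ... | no a≢0 = inj₂ (head≢0⇒isZero p q a≢0 h)
    ... | yes 0a = Sum.map₁ (0a ∷_) (conv-noZeroDivisors p q (λ k →
      trans (sym (trans (+-congʳ (trans (*-congʳ (IsZeroP⇒EqP n 0a)) (zeroˡ _))) (+-identityˡ _))) (h (suc k))))

    mulP-noZeroDivisors : ∀ p q → IsZeroP (suc n) (mulP (suc n) p q) → IsZeroP (suc n) p ⊎ IsZeroP (suc n) q
    mulP-noZeroDivisors p q h = conv-noZeroDivisors p q (λ k → trans (sym (coeff-* p q k)) (isZero-coeff h k))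

opaque
  -- Hiding the proofs of the laws leaves the operations of `polyRing` visible, because these come
  -- from the type.
  polyIsCommutativeRing : ∀ n → IsCommutativeRing (EqP n) (addP n) (mulP n) (negP n) (zeroP n) (constP n 1ℚ)
  polyIsCommutativeRing zero    = RationalPolynomials.isCommutativeRing
  polyIsCommutativeRing (suc n) = PolynomialExtension.isCommutativeRing n (polyIsCommutativeRing n)

  noZeroDivisors : ∀ n p q → IsZeroP n (mulP n p q) → IsZeroP n p ⊎ IsZeroP n q
  noZeroDivisors zero p q pq≡0 with p ℚ.≟ 0ℚ
  ... | yes p≡0 = inj₁ p≡0
  ... | no  p≢0 = inj₂ (begin
    q                         ≡⟨ ℚ.*-identityˡ q ⟨
    1ℚ ℚ.* q                  ≡⟨ ≡.cong (ℚ._* q) (ℚ.*-inverseˡ p) ⟨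
    (ℚ.1/ p) ℚ.* p ℚ.* q      ≡⟨ ℚ.*-assoc (ℚ.1/ p) p q ⟩
    (ℚ.1/ p) ℚ.* (p ℚ.* q)    ≡⟨ ≡.cong ((ℚ.1/ p) ℚ.*_) pq≡0 ⟩
    (ℚ.1/ p) ℚ.* 0ℚ           ≡⟨ ℚ.*-zeroʳ (ℚ.1/ p) ⟩
    0ℚ                        ∎)
    where
    open ≡.≡-Reasoning
    instance
      p-nonZero : ℚ.NonZero p
      p-nonZero = ℚ.≢-nonZero p≢0
  noZeroDivisors (suc n) =
    PolynomialExtension.mulP-noZeroDivisors n (polyIsCommutativeRing n) (noZeroDivisors n)

polyRing : ℕ → CommutativeRing _ _
polyRing n = record { isCommutativeRing = polyIsCommutativeRing n }

-- Evaluation of polynomials at a rational point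

module Evaluation (point : ℕ → ℚ) where
  open CommutativeRing ℚ.+-*-commutativeRing using (_+_; _*_; -_)
  open IntegerCoefficientSolver ℚ.+-*-commutativeRing
  open ≡.≡-Reasoning

  -- The variable adjoined in passing from `Poly n` to `Poly (suc n)` takes the value `point n`: the
  -- innermost variable comes first.
  evalP : ∀ n → Poly n → ℚ
  evalP zero    p       = p
  evalP (suc n) []      = 0ℚ
  evalP (suc n) (a ∷ p) = evalP n a + point n * evalP (suc n) p

  evalP-zero : ∀ n {p} → IsZeroP n p → evalP n p ≡ 0ℚ
  evalP-zero zero    p≡0 = p≡0
  evalP-zero (suc n) []  = ≡.refl
  evalP-zero (suc n) (0a ∷ 0p) = ≡.trans
    (≡.cong₂ (λ a p → a + point n * p) (evalP-zero n 0a) (evalP-zero (suc n) 0p))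
    (solve 1 (λ x → con (+ 0) :+ x :* con (+ 0) := con (+ 0)) ≡.refl (point n))

  evalP-zeroP : ∀ n → evalP n (zeroP n) ≡ 0ℚ
  evalP-zeroP zero    = ≡.refl
  evalP-zeroP (suc n) = ≡.refl

  evalP-+ : ∀ n p q → evalP n (addP n p q) ≡ evalP n p + evalP n q
  evalP-+ zero    p       q       = ≡.refl
  evalP-+ (suc n) []      q       = ≡.sym (ℚ.+-identityˡ _)
  evalP-+ (suc n) (_ ∷ _) []      = ≡.sym (ℚ.+-identityʳ _)
  evalP-+ (suc n) (a ∷ p) (b ∷ q) = ≡.trans
    (≡.cong₂ (λ c r → c + point n * r) (evalP-+ n a b) (evalP-+ (suc n) p q))
    (solve 5 (λ a b x p q → (a :+ b) :+ x :* (p :+ q) := (a :+ x :* p) :+ (b :+ x :* q)) ≡.refl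
       (evalP n a) (evalP n b) (point n) (evalP (suc n) p) (evalP (suc n) q))

  evalP-neg : ∀ n p → evalP n (negP n p) ≡ - evalP n p
  evalP-neg zero    p  = ≡.refl
  evalP-neg (suc n) [] = ≡.refl
  evalP-neg (suc n) (a ∷ p) = ≡.trans
    (≡.cong₂ (λ c r → c + point n * r) (evalP-neg n a) (evalP-neg (suc n) p))
    (solve 3 (λ a x p → (:- a) :+ x :* (:- p) := :- (a :+ x :* p)) ≡.refl
       (evalP n a) (point n) (evalP (suc n) p))

  mutual
    evalP-* : ∀ n p q → evalP n (mulP n p q) ≡ evalP n p * evalP n q
    evalP-* zero    p  q = ≡.refl
    evalP-* (suc n) [] q = ≡.sym (ℚ.*-zeroˡ (evalP (suc n) q))
    evalP-* (suc n) (a ∷ p) q = begin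
      evalP (suc n) (mulP (suc n) (a ∷ p) q)
        ≡⟨ evalP-+ (suc n) (map (mulP n a) q) (zeroP n ∷ mulP (suc n) p q) ⟩
      evalP (suc n) (map (mulP n a) q) + (evalP n (zeroP n) + point n * evalP (suc n) (mulP (suc n) p q))
        ≡⟨ ≡.cong₂ _+_ (evalP-scale n a q)
             (≡.cong₂ (λ z r → z + point n * r) (evalP-zeroP n) (evalP-* (suc n) p q)) ⟩
      evalP n a * evalP (suc n) q + (0ℚ + point n * (evalP (suc n) p * evalP (suc n) q))
        ≡⟨ solve 4 (λ a q x p → a :* q :+ (con (+ 0) :+ x :* (p :* q)) := (a :+ x :* p) :* q) ≡.refl
             (evalP n a) (evalP (suc n) q) (point n) (evalP (suc n) p) ⟩
      evalP (suc n) (a ∷ p) * evalP (suc n) q ∎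

    evalP-scale : ∀ n a q → evalP (suc n) (map (mulP n a) q) ≡ evalP n a * evalP (suc n) q
    evalP-scale n a []      = ≡.sym (ℚ.*-zeroʳ (evalP n a))
    evalP-scale n a (b ∷ q) = ≡.trans
      (≡.cong₂ (λ c r → c + point n * r) (evalP-* n a b) (evalP-scale n a q))
      (solve 4 (λ a b x q → a :* b :+ x :* (a :* q) := a :* (b :+ x :* q)) ≡.refl
         (evalP n a) (evalP n b) (point n) (evalP (suc n) q))

-- The field of fractions

-- Every fraction operation is specified only up to cross-multiplication, so
-- that the normalisation performed by mkK never has to be unfolded.
record FractionOperations {c ℓ} (P : CommutativeRing c ℓ) : Set (Level.suc (c ⊔ ℓ)) where
  open CommutativeRing P
  field
    integral  : ∀ a b → a * b ≈ 0# → a ≈ 0# ⊎ b ≈ 0#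
    Fraction  : Set c
    num den   : Fraction → Carrier
    den≉0     : ∀ x → ¬ den x ≈ 0#
    _⊞_ _⊠_   : Fraction → Fraction → Fraction
    ⊟_ inv    : Fraction → Fraction
    zeroF oneF : Fraction
    ⊞-spec    : ∀ x y → num (x ⊞ y) * (den x * den y) ≈ (num x * den y + num y * den x) * den (x ⊞ y)
    ⊠-spec    : ∀ x y → num (x ⊠ y) * (den x * den y) ≈ (num x * num y) * den (x ⊠ y)
    ⊟-spec    : ∀ x → num (⊟ x) * den x ≈ - num x * den (⊟ x)
    zeroF-spec : num zeroF ≈ 0#
    oneF-spec : num oneF ≈ den oneF
    inv-spec  : ∀ x → ¬ num x ≈ 0# → num (inv x) * num x ≈ den x * den (inv x)

module Fractions {c ℓ} {P : CommutativeRing c ℓ} (O : FractionOperations P) where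
  open CommutativeRing P hiding (isCommutativeRing)
  open FractionOperations O
  open IntegerCoefficientSolver P
  open import Relation.Binary.Reasoning.Setoid setoid
  open import Algebra.Properties.Ring ring using (x∙y⁻¹≈ε⇒x≈y; x≈y⇒x∙y⁻¹≈ε)

  *-cancelˡ : ∀ {a x y} → ¬ a ≈ 0# → a * x ≈ a * y → x ≈ y
  *-cancelˡ {a} {x} {y} a≉0 ax≈ay with integral a (x - y) (begin
      a * (x - y)    ≈⟨ solve 3 (λ a x y → a :* (x :- y) := a :* x :- a :* y) refl a x y ⟩
      a * x - a * y  ≈⟨ x≈y⇒x∙y⁻¹≈ε ax≈ay ⟩
      0#             ∎)
  ... | inj₁ a≈0   = ⊥-elim (a≉0 a≈0)
  ... | inj₂ x-y≈0 = x∙y⁻¹≈ε⇒x≈y x y x-y≈0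

  *-≉0 : ∀ {a b} → ¬ a ≈ 0# → ¬ b ≈ 0# → ¬ a * b ≈ 0#
  *-≉0 {a} {b} a≉0 b≉0 ab≈0 with integral a b ab≈0
  ... | inj₁ a≈0 = a≉0 a≈0
  ... | inj₂ b≈0 = b≉0 b≈0

  infix 4 _≈F_
  _≈F_ : Fraction → Fraction → Set ℓ
  x ≈F y = num x * den y ≈ num y * den x

  -- Says that x equals p / q for a pair that need not be its own numerator and denominator. Results
  -- of operations thus get the textbook numerators and denominators, whatever normalisation has
  -- done to the stored ones.
  record Represents (x : Fraction) (p q : Carrier) : Set ℓ where
    constructor represents
    field
      q≉0   : ¬ q ≈ 0#
      cross : num x * q ≈ p * den x
  open Represents

  -- Reduces every law of fractions to one polynomial identity between representing pairs, after
  -- cancelling the nonzero product `q * q′`.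
  unique : ∀ {x y p q p′ q′} → Represents x p q → Represents y p′ q′ → p * q′ ≈ p′ * q → x ≈F y
  unique {x} {y} {p} {q} {p′} {q′} rx ry eq = *-cancelˡ (*-≉0 (q≉0 rx) (q≉0 ry)) (begin
    q * q′ * (num x * den y)    ≈⟨ solve 4 (λ q q′ a b → q :* q′ :* (a :* b) := (a :* q) :* (q′ :* b)) refl q q′ (num x) (den y) ⟩
    num x * q * (q′ * den y)    ≈⟨ *-congʳ (cross rx) ⟩
    p * den x * (q′ * den y)    ≈⟨ solve 4 (λ p d q′ b → p :* d :* (q′ :* b) := (p :* q′) :* (d :* b)) refl p (den x) q′ (den y) ⟩
    p * q′ * (den x * den y)    ≈⟨ *-congʳ eq ⟩
    p′ * q * (den x * den y)    ≈⟨ solve 4 (λ p d q′ b → p :* q′ :* (d :* b) := (p :* b) :* (q′ :* d)) refl p′ (den x) q (den y) ⟩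
    p′ * den y * (q * den x)    ≈⟨ *-congʳ (cross ry) ⟨
    num y * q′ * (q * den x)    ≈⟨ solve 4 (λ q q′ a b → (a :* q′) :* (q :* b) := q :* q′ :* (a :* b)) refl q q′ (num y) (den x) ⟩
    q * q′ * (num y * den x)    ∎)

  rep : ∀ x → Represents x (num x) (den x)
  rep x = represents (den≉0 x) refl

  rep-≈ : ∀ {x y} → x ≈F y → Represents x (num y) (den y)
  rep-≈ {x} {y} x≈y = represents (den≉0 y) x≈y

  rep-⊞ : ∀ {x y p q p′ q′} → Represents x p q → Represents y p′ q′ → Represents (x ⊞ y) (p * q′ + p′ * q) (q * q′)
  rep-⊞ {x} {y} {p} {q} {p′} {q′} rx ry = represents (*-≉0 (q≉0 rx) (q≉0 ry))
    (*-cancelˡ (*-≉0 (den≉0 x) (den≉0 y)) (begin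
      dx * dy * (n * (q * q′))
        ≈⟨ solve 5 (λ dx dy n q q′ → dx :* dy :* (n :* (q :* q′)) := n :* (dx :* dy) :* (q :* q′)) refl dx dy n q q′ ⟩
      n * (dx * dy) * (q * q′)
        ≈⟨ *-congʳ (⊞-spec x y) ⟩
      (num x * dy + num y * dx) * d * (q * q′)
        ≈⟨ solve 7 (λ nx ny dx dy d q q′ → (nx :* dy :+ ny :* dx) :* d :* (q :* q′)
             := ((nx :* q) :* (q′ :* dy) :+ (ny :* q′) :* (q :* dx)) :* d) refl (num x) (num y) dx dy d q q′ ⟩
      (num x * q * (q′ * dy) + num y * q′ * (q * dx)) * d
        ≈⟨ *-congʳ (+-cong (*-congʳ (cross rx)) (*-congʳ (cross ry))) ⟩
      (p * dx * (q′ * dy) + p′ * dy * (q * dx)) * d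
        ≈⟨ solve 7 (λ p p′ dx dy d q q′ → (p :* dx :* (q′ :* dy) :+ p′ :* dy :* (q :* dx)) :* d
             := dx :* dy :* ((p :* q′ :+ p′ :* q) :* d)) refl p p′ dx dy d q q′ ⟩
      dx * dy * ((p * q′ + p′ * q) * d) ∎))
    where
    n = num (x ⊞ y); d = den (x ⊞ y); dx = den x; dy = den y

  rep-⊠ : ∀ {x y p q p′ q′} → Represents x p q → Represents y p′ q′ → Represents (x ⊠ y) (p * p′) (q * q′)
  rep-⊠ {x} {y} {p} {q} {p′} {q′} rx ry = represents (*-≉0 (q≉0 rx) (q≉0 ry))
    (*-cancelˡ (*-≉0 (den≉0 x) (den≉0 y)) (begin
      dx * dy * (n * (q * q′))
        ≈⟨ solve 5 (λ dx dy n q q′ → dx :* dy :* (n :* (q :* q′)) := n :* (dx :* dy) :* (q :* q′)) refl dx dy n q q′ ⟩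
      n * (dx * dy) * (q * q′)
        ≈⟨ *-congʳ (⊠-spec x y) ⟩
      num x * num y * d * (q * q′)
        ≈⟨ solve 5 (λ nx ny d q q′ → nx :* ny :* d :* (q :* q′) := (nx :* q) :* (ny :* q′) :* d) refl (num x) (num y) d q q′ ⟩
      num x * q * (num y * q′) * d
        ≈⟨ *-congʳ (*-cong (cross rx) (cross ry)) ⟩
      p * dx * (p′ * dy) * d
        ≈⟨ solve 5 (λ p p′ dx dy d → p :* dx :* (p′ :* dy) :* d := dx :* dy :* (p :* p′ :* d)) refl p p′ dx dy d ⟩
      dx * dy * (p * p′ * d) ∎))
    where
    n = num (x ⊠ y); d = den (x ⊠ y); dx = den x; dy = den y

  rep-⊟ : ∀ {x p q} → Represents x p q → Represents (⊟ x) (- p) q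
  rep-⊟ {x} {p} {q} rx = represents (q≉0 rx) (*-cancelˡ (den≉0 x) (begin
    dx * (n * q)           ≈⟨ solve 3 (λ dx n q → dx :* (n :* q) := n :* dx :* q) refl dx n q ⟩
    n * dx * q             ≈⟨ *-congʳ (⊟-spec x) ⟩
    - num x * d * q        ≈⟨ solve 3 (λ a d q → (:- a) :* d :* q := (:- (a :* q)) :* d) refl (num x) d q ⟩
    - (num x * q) * d      ≈⟨ *-congʳ (-‿cong (cross rx)) ⟩
    - (p * dx) * d         ≈⟨ solve 3 (λ p dx d → (:- (p :* dx)) :* d := dx :* ((:- p) :* d)) refl p dx d ⟩
    dx * (- p * d)         ∎))
    where
    n = num (⊟ x); d = den (⊟ x); dx = den x

  1≉0 : ¬ 1# ≈ 0#
  1≉0 1≈0 = den≉0 oneF (trans (sym (*-identityˡ _)) (trans (*-congʳ 1≈0) (zeroˡ _)))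

  rep-zeroF : Represents zeroF 0# 1#
  rep-zeroF = represents 1≉0 (trans (*-congʳ zeroF-spec) (trans (zeroˡ 1#) (sym (zeroˡ _))))

  rep-oneF : Represents oneF 1# 1#
  rep-oneF = represents 1≉0 (trans (*-congʳ oneF-spec) (*-comm _ _))

  ≈zeroF⇒num≈0 : ∀ {x} → x ≈F zeroF → num x ≈ 0#
  ≈zeroF⇒num≈0 {x} x≈0 = *-cancelˡ (den≉0 zeroF) (begin
    den zeroF * num x    ≈⟨ *-comm _ _ ⟩
    num x * den zeroF    ≈⟨ x≈0 ⟩
    num zeroF * den x    ≈⟨ *-congʳ zeroF-spec ⟩
    0# * den x           ≈⟨ zeroˡ _ ⟩
    0#                   ≈⟨ zeroʳ _ ⟨
    den zeroF * 0#       ∎)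

  -- Contraposed, this proves a fraction nonzero from any representing pair, without knowledge of
  -- its stored numerator.
  represents-zeroF : ∀ {x p q} → Represents x p q → x ≈F zeroF → p ≈ 0#
  represents-zeroF {x} {p} {q} rx x≈0 = *-cancelˡ (den≉0 x) (begin
    den x * p    ≈⟨ *-comm _ _ ⟩
    p * den x    ≈⟨ cross rx ⟨
    num x * q    ≈⟨ *-congʳ (≈zeroF⇒num≈0 x≈0) ⟩
    0# * q       ≈⟨ zeroˡ q ⟩
    0#           ≈⟨ zeroʳ _ ⟨
    den x * 0#   ∎)

  ⊠-inverseʳ : ∀ x → ¬ x ≈F zeroF → x ⊠ inv x ≈F oneF
  ⊠-inverseʳ x x≉0 = unique (rep-⊠ (rep x) (represents n≉0 (inv-spec x n≉0))) rep-oneF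
    (solve 2 (λ n d → n :* d :* con (+ 1) := con (+ 1) :* (d :* n)) refl (num x) (den x))
    where
    n≉0 : ¬ num x ≈ 0#
    n≉0 n≈0 = x≉0 (trans (*-congʳ n≈0) (trans (zeroˡ _) (sym (trans (*-congʳ zeroF-spec) (zeroˡ _)))))

  isCommutativeRing : IsCommutativeRing _≈F_ _⊞_ _⊠_ ⊟_ zeroF oneF
  isCommutativeRing = record
    { isRing = record
      { +-isAbelianGroup = record
        { isGroup = record
          { isMonoid = record
            { isSemigroup = record
              { isMagma = record
                { isEquivalence = record
                  { refl = refl ; sym = sym
                  -- Both ends are represented by the numerator and denominator of y, so that
                  -- `unique` does the cancelling.
                  ; trans = λ {x} {y} {z} x≈y y≈z → unique (rep-≈ x≈y) (rep-≈ {z} {y} (sym y≈z)) refl }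
                ; ∙-cong = λ {x} {x′} {y} {y′} p q → unique (rep-⊞ (rep-≈ p) (rep-≈ q)) (rep-⊞ (rep x′) (rep y′)) refl }
              ; assoc = λ x y z → unique (rep-⊞ (rep-⊞ (rep x) (rep y)) (rep z)) (rep-⊞ (rep x) (rep-⊞ (rep y) (rep z)))
                  (solve 6 (λ a b c d e f → ((a :* d :+ c :* b) :* f :+ e :* (b :* d)) :* (b :* (d :* f))
                      := (a :* (d :* f) :+ (c :* f :+ e :* d) :* b) :* (b :* d :* f)) refl
                    (num x) (den x) (num y) (den y) (num z) (den z)) }
            ; identity =
                (λ x → unique (rep-⊞ rep-zeroF (rep x)) (rep x)
                  (solve 2 (λ n d → (con (+ 0) :* d :+ n :* con (+ 1)) :* d := n :* (con (+ 1) :* d)) refl (num x) (den x)))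
              , (λ x → unique (rep-⊞ (rep x) rep-zeroF) (rep x)
                  (solve 2 (λ n d → (n :* con (+ 1) :+ con (+ 0) :* d) :* d := n :* (d :* con (+ 1))) refl (num x) (den x))) }
          ; inverse =
              (λ x → unique (rep-⊞ (rep-⊟ (rep x)) (rep x)) rep-zeroF
                (solve 2 (λ n d → ((:- n) :* d :+ n :* d) :* con (+ 1) := con (+ 0) :* (d :* d)) refl (num x) (den x)))
            , (λ x → unique (rep-⊞ (rep x) (rep-⊟ (rep x))) rep-zeroF
                (solve 2 (λ n d → (n :* d :+ (:- n) :* d) :* con (+ 1) := con (+ 0) :* (d :* d)) refl (num x) (den x)))
          ; ⁻¹-cong = λ {x} {y} p → unique (rep-⊟ (rep-≈ p)) (rep-⊟ (rep y)) refl }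
        ; comm = λ x y → unique (rep-⊞ (rep x) (rep y)) (rep-⊞ (rep y) (rep x))
            (solve 4 (λ a b c d → (a :* d :+ c :* b) :* (d :* b) := (c :* b :+ a :* d) :* (b :* d)) refl
              (num x) (den x) (num y) (den y)) }
      ; *-cong = λ {x} {x′} {y} {y′} p q → unique (rep-⊠ (rep-≈ p) (rep-≈ q)) (rep-⊠ (rep x′) (rep y′)) refl
      ; *-assoc = λ x y z → unique (rep-⊠ (rep-⊠ (rep x) (rep y)) (rep z)) (rep-⊠ (rep x) (rep-⊠ (rep y) (rep z)))
          (solve 6 (λ a b c d e f → (a :* c :* e) :* (b :* (d :* f)) := (a :* (c :* e)) :* (b :* d :* f)) refl
            (num x) (den x) (num y) (den y) (num z) (den z))
      ; *-identity =
          (λ x → unique (rep-⊠ rep-oneF (rep x)) (rep x)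
            (solve 2 (λ n d → con (+ 1) :* n :* d := n :* (con (+ 1) :* d)) refl (num x) (den x)))
        , (λ x → unique (rep-⊠ (rep x) rep-oneF) (rep x)
            (solve 2 (λ n d → n :* con (+ 1) :* d := n :* (d :* con (+ 1))) refl (num x) (den x)))
      ; distrib =
          (λ x y z → unique (rep-⊠ (rep x) (rep-⊞ (rep y) (rep z))) (rep-⊞ (rep-⊠ (rep x) (rep y)) (rep-⊠ (rep x) (rep z)))
            (solve 6 (λ a b c d e f → (a :* (c :* f :+ e :* d)) :* (b :* d :* (b :* f))
                := (a :* c :* (b :* f) :+ a :* e :* (b :* d)) :* (b :* (d :* f))) refl
              (num x) (den x) (num y) (den y) (num z) (den z)))
        , (λ x y z → unique (rep-⊠ (rep-⊞ (rep y) (rep z)) (rep x)) (rep-⊞ (rep-⊠ (rep y) (rep x)) (rep-⊠ (rep z) (rep x)))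
            (solve 6 (λ a b c d e f → ((c :* f :+ e :* d) :* a) :* (d :* b :* (f :* b))
                := (c :* a :* (f :* b) :+ e :* a :* (d :* b)) :* (d :* f :* b)) refl
              (num x) (den x) (num y) (den y) (num z) (den z))) }
    ; *-comm = λ x y → unique (rep-⊠ (rep x) (rep y)) (rep-⊠ (rep y) (rep x))
        (solve 4 (λ a b c d → (a :* c) :* (d :* b) := (c :* a) :* (b :* d)) refl (num x) (den x) (num y) (den y)) }

mkK-spec : ∀ p q → ¬ IsZeroP 3 q → EqP 3 (mulP 3 (K.num (mkK p q)) q) (mulP 3 p (K.den (mkK p q)))
mkK-spec p q q≢0 with isZeroP? 3 q
... | yes 0q = ⊥-elim (q≢0 0q)
... | no  _  = CommutativeRing.refl (polyRing 3) {mulP 3 p q}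

opaque
  den-*≢0 : ∀ x y → ¬ IsZeroP 3 (mulP 3 (K.den x) (K.den y))
  den-*≢0 x y h with noZeroDivisors 3 (K.den x) (K.den y) h
  ... | inj₁ 0x = K.den≢0 x 0x
  ... | inj₂ 0y = K.den≢0 y 0y

  +K-spec : ∀ x y → EqP 3 (mulP 3 (K.num (x +K y)) (mulP 3 (K.den x) (K.den y)))
    (mulP 3 (addP 3 (mulP 3 (K.num x) (K.den y)) (mulP 3 (K.num y) (K.den x))) (K.den (x +K y)))
  +K-spec x y = mkK-spec (addP 3 (mulP 3 (K.num x) (K.den y)) (mulP 3 (K.num y) (K.den x)))
    (mulP 3 (K.den x) (K.den y)) (den-*≢0 x y)

  *K-spec : ∀ x y → EqP 3 (mulP 3 (K.num (x *K y)) (mulP 3 (K.den x) (K.den y)))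
    (mulP 3 (mulP 3 (K.num x) (K.num y)) (K.den (x *K y)))
  *K-spec x y = mkK-spec (mulP 3 (K.num x) (K.num y)) (mulP 3 (K.den x) (K.den y)) (den-*≢0 x y)

fractionOperations : FractionOperations (polyRing 3)
fractionOperations = record
  { integral = λ a b ab≈0 → Sum.map (IsZeroP⇒EqP 3) (IsZeroP⇒EqP 3) (noZeroDivisors 3 a b (EqP⇒IsZeroP 3 ab≈0))
  ; Fraction = K ; num = K.num ; den = K.den
  ; den≉0 = λ x d≈0 → K.den≢0 x (EqP⇒IsZeroP 3 d≈0)
  ; _⊞_ = _+K_ ; _⊠_ = _*K_ ; ⊟_ = -K_ ; inv = invK ; zeroF = 0K ; oneF = 1K
  ; ⊞-spec = +K-spec ; ⊠-spec = *K-spec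
  ; ⊟-spec = λ x → CommutativeRing.refl (polyRing 3) {mulP 3 (negP 3 (K.num x)) (K.den x)}
  ; zeroF-spec = CommutativeRing.refl (polyRing 3) {zeroP 3}
  ; oneF-spec = CommutativeRing.refl (polyRing 3) {constP 3 1ℚ}
  ; inv-spec = λ x n≉0 → mkK-spec (K.den x) (K.num x) (λ 0n → n≉0 (IsZeroP⇒EqP 3 0n)) }

opaque
  kIsCommutativeRing : IsCommutativeRing _≈K_ _+K_ _*K_ -K_ 0K 1K
  kIsCommutativeRing = Fractions.isCommutativeRing fractionOperations

  *K-inverseʳ : ∀ x → ¬ x ≈K 0K → x *K invK x ≈K 1K
  *K-inverseʳ = Fractions.⊠-inverseʳ fractionOperations

kRing : CommutativeRing _ _
kRing = record { isCommutativeRing = kIsCommutativeRing }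

-- Convergents and the quadratic equation

module QuadraticIdentities {c ℓ} (S : CommutativeRing c ℓ) where
  open CommutativeRing S
  open IntegerCoefficientSolver S
  open import Relation.Binary.Reasoning.Setoid setoid

  leading middle : (p q y s x : Carrier) → Carrier
  leading p q y s x =
    (q * q + y * p * q + p * p) * (x * x * (x * x)) - s * (p * q) * (x * x * x) + p * q * (x * x)
  middle p q y s x = (- (y * (q * q)) - (1# + 1#) * (p * q)) * (x * x) + s * (q * q) * x - q * q

  -- The equation of f_n reads quadratic p q y s x f_n = 0 with p = α_{n-1} and q = α_n.
  quadratic : (p q y s x f : Carrier) → Carrier
  quadratic p q y s x f = leading p q y s x * f * f + middle p q y s x * f + q * q

  quadratic-cong : ∀ {p q y s x f g} → f ≈ g → quadratic p q y s x f ≈ quadratic p q y s x g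
  quadratic-cong f≈g = +-congʳ (+-cong (*-cong (*-congˡ f≈g) f≈g) (*-congˡ f≈g))

  -- The left side is bracketed as in `FEq`, with a, b and d already expressed through p and q.
  -- Since d = -q², moving d across turns the equation into a root of `quadratic`.
  quadratic-equation : ∀ p q y s x f →
    ((q * q + y * p * q + p * p) * (x * x * x * x) - s * (p * q) * (x * x * x) + p * q * (x * x)) * f * f
      + ((y * - (q * q) - (1# + 1#) * (p * q)) * (x * x) - s * - (q * q) * x + - (q * q)) * f
    ≈ quadratic p q y s x f - q * q
  quadratic-equation = solve 6 (λ p q y s x f →
    ((q :* q :+ y :* p :* q :+ p :* p) :* (x :* x :* x :* x) :- s :* (p :* q) :* (x :* x :* x) :+ p :* q :* (x :* x)) :* f :* f
      :+ ((y :* (:- (q :* q)) :- con (+ 2) :* (p :* q)) :* (x :* x) :- s :* (:- (q :* q)) :* x :+ (:- (q :* q))) :* f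
    := ((q :* q :+ y :* p :* q :+ p :* p) :* (x :* x :* (x :* x)) :- s :* (p :* q) :* (x :* x :* x) :+ p :* q :* (x :* x)) :* f :* f
      :+ ((:- (y :* (q :* q)) :- con (+ 2) :* (p :* q)) :* (x :* x) :+ s :* (q :* q) :* x :- q :* q) :* f
      :+ q :* q :- q :* q) refl

  -- The convergent with no level: the constant terms -q² and q² cancel, which leaves a multiple of
  -- x.
  quadratic-at-1 : ∀ p q y s x → quadratic p q y s x 1# ≈ x *
    ((q * q + y * p * q + p * p) * (x * x * x) - s * (p * q) * (x * x) + p * q * x
      + (- (y * (q * q)) - (1# + 1#) * (p * q)) * x + s * (q * q))
  quadratic-at-1 = solve 5 (λ p q y s x →
    ((q :* q :+ y :* p :* q :+ p :* p) :* (x :* x :* (x :* x)) :- s :* (p :* q) :* (x :* x :* x) :+ p :* q :* (x :* x)) :* con (+ 1) :* con (+ 1)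
      :+ ((:- (y :* (q :* q)) :- con (+ 2) :* (p :* q)) :* (x :* x) :+ s :* (q :* q) :* x :- q :* q) :* con (+ 1) :+ q :* q
    := x :* ((q :* q :+ y :* p :* q :+ p :* p) :* (x :* x :* x) :- s :* (p :* q) :* (x :* x) :+ p :* q :* x
      :+ (:- (y :* (q :* q)) :- con (+ 2) :* (p :* q)) :* x :+ s :* (q :* q))) refl

  -- The terms without an explicit factor `x * x` are q² - q² f (1 - s x). Adding and subtracting q²
  -- v x² f turns them into q² (1 - f N), where N is the denominator of f; this vanishes, and the
  -- rest is divisible by `x * x`.
  quadratic-at-first-convergent : ∀ {p q y s x v f} → f * (1# - s * x - v * (x * x)) ≈ 1# →
    quadratic p q y s x f ≈ x * (x *
      (((q * q + y * p * q + p * p) * (x * x) - s * (p * q) * x + p * q) * f * f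
        + (- (q * q * v) - y * (q * q) - (1# + 1#) * (p * q)) * f))
  quadratic-at-first-convergent {p} {q} {y} {s} {x} {v} {f} fN≈1 = begin
    quadratic p q y s x f
      ≈⟨ solve 7 (λ p q y s x v f →
        ((q :* q :+ y :* p :* q :+ p :* p) :* (x :* x :* (x :* x)) :- s :* (p :* q) :* (x :* x :* x) :+ p :* q :* (x :* x)) :* f :* f
          :+ ((:- (y :* (q :* q)) :- con (+ 2) :* (p :* q)) :* (x :* x) :+ s :* (q :* q) :* x :- q :* q) :* f :+ q :* q
        := x :* (x :* (((q :* q :+ y :* p :* q :+ p :* p) :* (x :* x) :- s :* (p :* q) :* x :+ p :* q) :* f :* f
              :+ (:- (q :* q :* v) :- y :* (q :* q) :- con (+ 2) :* (p :* q)) :* f))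
          :+ (q :* q :- q :* q :* (f :* (con (+ 1) :- s :* x :- v :* (x :* x))))) refl p q y s x v f ⟩
    H + (q * q - q * q * (f * (1# - s * x - v * (x * x))))
      ≈⟨ +-congˡ (+-congˡ (-‿cong (*-congˡ fN≈1))) ⟩
    H + (q * q - q * q * 1#)
      ≈⟨ solve 2 (λ h q → h :+ (q :* q :- q :* q :* con (+ 1)) := h) refl H q ⟩
    H ∎
    where
    H = x * (x * (((q * q + y * p * q + p * p) * (x * x) - s * (p * q) * x + p * q) * f * f
        + (- (q * q * v) - y * (q * q) - (1# + 1#) * (p * q)) * f))

  quadratic-difference : ∀ p q y s x f g →
    quadratic p q y s x f - quadratic p q y s x g ≈ (f - g) * (leading p q y s x * (f + g) + middle p q y s x)
  quadratic-difference p q y s x f g = solve 5 (λ a b c f g →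
    (a :* f :* f :+ b :* f :+ c) :- (a :* g :* g :+ b :* g :+ c) := (f :- g) :* (a :* (f :+ g) :+ b)) refl
    (leading p q y s x) (middle p q y s x) (q * q) f g

  -- Isolates the constant term -q² of the difference quotient; its invertibility is what transfers
  -- closeness from values to arguments.
  quadratic-slope : ∀ p q y s x h → leading p q y s x * h + middle p q y s x ≈
    x * (((q * q + y * p * q + p * p) * (x * x * x) - s * (p * q) * (x * x) + p * q * x) * h
      + (- (y * (q * q)) - (1# + 1#) * (p * q)) * x + s * (q * q)) - q * q
  quadratic-slope = solve 6 (λ p q y s x h →
    ((q :* q :+ y :* p :* q :+ p :* p) :* (x :* x :* (x :* x)) :- s :* (p :* q) :* (x :* x :* x) :+ p :* q :* (x :* x)) :* h
      :+ ((:- (y :* (q :* q)) :- con (+ 2) :* (p :* q)) :* (x :* x) :+ s :* (q :* q) :* x :- q :* q)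
    := x :* (((q :* q :+ y :* p :* q :+ p :* p) :* (x :* x :* x) :- s :* (p :* q) :* (x :* x) :+ p :* q :* x) :* h
      :+ (:- (y :* (q :* q)) :- con (+ 2) :* (p :* q)) :* x :+ s :* (q :* q)) :- q :* q) refl

  module _ {p q r y s x v v′ q⁻¹ r⁻¹ f g F}
    (r-rec : r ≈ - (y * q) - p) (q-inv : q * q⁻¹ ≈ 1#) (r-inv : r * r⁻¹ ≈ 1#)
    (v-def : v * q ≈ r) (v′-def : v′ * r ≈ q)
    (f-def : f * (1# - s * x - v * (x * x * g)) ≈ 1#)
    (g-def : g * (1# - v′ * (x * x * F)) ≈ 1#) where

    -- Here g = r / W and f = q W / D. Since D = q r / (f g), the element E = f g / (q r) is its
    -- inverse.
    W D E : Carrier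
    W = r - q * (x * x * F)
    D = q * (1# - s * x) * W - r * r * (x * x)
    E = f * q⁻¹ * (g * r⁻¹)

    private
      N = 1# - s * x - v * (x * x * g)

      gW≈r : g * W ≈ r
      gW≈r = begin
        g * (r - q * (x * x * F))               ≈⟨ *-congˡ (+-congˡ (-‿cong (*-congʳ v′-def))) ⟨
        g * (r - v′ * r * (x * x * F))          ≈⟨ solve 4 (λ g r v t → g :* (r :- v :* r :* t) := r :* (g :* (con (+ 1) :- v :* t))) refl g r v′ (x * x * F) ⟩
        r * (g * (1# - v′ * (x * x * F)))       ≈⟨ *-congˡ g-def ⟩
        r * 1#                                  ≈⟨ *-identityʳ r ⟩
        r                                       ∎

      D≈qWN : D ≈ q * W * N
      D≈qWN = begin
        q * (1# - s * x) * W - r * r * (x * x)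
          ≈⟨ +-congˡ (-‿cong (*-congʳ (*-cong v-def gW≈r))) ⟨
        q * (1# - s * x) * W - v * q * (g * W) * (x * x)
          ≈⟨ solve 6 (λ q s x w v g → q :* (con (+ 1) :- s :* x) :* w :- v :* q :* (g :* w) :* (x :* x)
              := q :* w :* (con (+ 1) :- s :* x :- v :* (x :* x :* g))) refl q s x W v g ⟩
        q * W * N ∎

      fD≈qW : f * D ≈ q * W
      fD≈qW = begin
        f * D              ≈⟨ *-congˡ D≈qWN ⟩
        f * (q * W * N)    ≈⟨ solve 4 (λ f q w n → f :* (q :* w :* n) := q :* w :* (f :* n)) refl f q W N ⟩
        q * W * (f * N)    ≈⟨ *-congˡ f-def ⟩
        q * W * 1#         ≈⟨ *-identityʳ _ ⟩
        q * W              ∎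

      DE≈1 : D * E ≈ 1#
      DE≈1 = begin
        D * E                                         ≈⟨ *-congʳ D≈qWN ⟩
        q * W * N * (f * q⁻¹ * (g * r⁻¹))
          ≈⟨ solve 7 (λ q w n f q⁻ g r⁻ → q :* w :* n :* (f :* q⁻ :* (g :* r⁻)) := q :* q⁻ :* (f :* n) :* ((g :* w) :* r⁻))
               refl q W N f q⁻¹ g r⁻¹ ⟩
        q * q⁻¹ * (f * N) * (g * W * r⁻¹)             ≈⟨ *-cong (*-cong q-inv f-def) (trans (*-congʳ gW≈r) r-inv) ⟩
        1# * 1# * 1#                                  ≈⟨ solve 0 (con (+ 1) :* con (+ 1) :* con (+ 1) := con (+ 1)) refl ⟩
        1#                                            ∎

    -- The quadratic form of level n in homogeneous coordinates, taken at (q W, D), is a multiple of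
    -- the form of level n + 1 at F. This is where the recurrence of the α_n enters.
    quadratic-step-W : leading p q y s x * (q * W) * (q * W) + middle p q y s x * (q * W) * D + q * q * D * D
      ≈ q * q * (q * q) * (x * x * (x * x)) * quadratic q r y s x F
    -- The element r is only equivalent to -(y q) - p; it is replaced on both sides, so that a
    -- polynomial identity in six free variables remains for the solver.
    quadratic-step-W = trans (lhs-cong r-rec) (trans (identity p q y s x F) (sym (rhs-cong r-rec)))
      where
      lhs rhs : Carrier → Carrier
      lhs r = let W = r - q * (x * x * F); D = q * (1# - s * x) * W - r * r * (x * x) in
        leading p q y s x * (q * W) * (q * W) + middle p q y s x * (q * W) * D + q * q * D * D
      rhs r = q * q * (q * q) * (x * x * (x * x)) * quadratic q r y s x F
      lhs-cong : ∀ {r r′} → r ≈ r′ → lhs r ≈ lhs r′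
      lhs-cong r≈ = +-cong (+-cong (*-cong (*-congˡ qW≈) qW≈) (*-cong (*-congˡ qW≈) D≈)) (*-cong (*-congˡ D≈) D≈)
        where
        qW≈ = *-congˡ (+-congʳ r≈)
        D≈  = +-cong (*-congˡ (+-congʳ r≈)) (-‿cong (*-congʳ (*-cong r≈ r≈)))
      rhs-cong : ∀ {r r′} → r ≈ r′ → rhs r ≈ rhs r′
      rhs-cong r≈ = *-congˡ (+-cong (+-cong
        (*-congʳ (*-congʳ (+-cong (+-cong (*-congʳ (+-cong (+-cong rr (*-congˡ r≈)) refl)) (-‿cong (*-congʳ (*-congˡ qr)))) (*-congʳ qr))))
        (*-congʳ (+-cong (+-cong (*-congʳ (+-cong (-‿cong (*-congˡ rr)) (-‿cong (*-congˡ qr)))) (*-congʳ (*-congˡ rr))) (-‿cong rr))))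
        rr)
        where
        rr = *-cong r≈ r≈
        qr = *-congˡ r≈
      identity : ∀ p q y s x F →
        let r = - (y * q) - p; W = r - q * (x * x * F); D = q * (1# - s * x) * W - r * r * (x * x) in
        leading p q y s x * (q * W) * (q * W) + middle p q y s x * (q * W) * D + q * q * D * D
        ≈ q * q * (q * q) * (x * x * (x * x)) * quadratic q r y s x F
      identity = solve 6 (λ p q y s x F →
        let r = :- (y :* q) :- p; W = r :- q :* (x :* x :* F); D = q :* (con (+ 1) :- s :* x) :* W :- r :* r :* (x :* x)
            lead = λ p q → (q :* q :+ y :* p :* q :+ p :* p) :* (x :* x :* (x :* x)) :- s :* (p :* q) :* (x :* x :* x) :+ p :* q :* (x :* x)
            mid = λ p q → (:- (y :* (q :* q)) :- con (+ 2) :* (p :* q)) :* (x :* x) :+ s :* (q :* q) :* x :- q :* q in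
        lead p q :* (q :* W) :* (q :* W) :+ mid p q :* (q :* W) :* D :+ q :* q :* D :* D
        := q :* q :* (q :* q) :* (x :* x :* (x :* x)) :* (lead q r :* F :* F :+ mid q r :* F :+ r :* r)) refl

    -- Multiplying by (D E)² = 1 clears the denominator D. The factors x stand outermost, one by
    -- one, ready for `ord-X`.
    quadratic-step : quadratic p q y s x f ≈
      x * (x * (x * (x * (quadratic q r y s x F * (q * q * (q * q) * (E * E))))))
    quadratic-step = begin
      quadratic p q y s x f
        ≈⟨ solve 1 (λ t → t := t :* (con (+ 1) :* con (+ 1))) refl _ ⟩
      quadratic p q y s x f * (1# * 1#)
        ≈⟨ *-congˡ (*-cong DE≈1 DE≈1) ⟨
      quadratic p q y s x f * (D * E * (D * E))
        ≈⟨ solve 6 (λ a b c f d e → (a :* f :* f :+ b :* f :+ c) :* (d :* e :* (d :* e))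
            := (a :* (f :* d) :* (f :* d) :+ b :* (f :* d) :* d :+ c :* d :* d) :* (e :* e)) refl
             (leading p q y s x) (middle p q y s x) (q * q) f D E ⟩
      (leading p q y s x * (f * D) * (f * D) + middle p q y s x * (f * D) * D + q * q * D * D) * (E * E)
        ≈⟨ *-congʳ (+-congʳ (+-cong (*-cong (*-congˡ fD≈qW) fD≈qW) (*-congʳ (*-congˡ fD≈qW)))) ⟩
      (leading p q y s x * (q * W) * (q * W) + middle p q y s x * (q * W) * D + q * q * D * D) * (E * E)
        ≈⟨ *-congʳ quadratic-step-W ⟩
      q * q * (q * q) * (x * x * (x * x)) * quadratic q r y s x F * (E * E)
        ≈⟨ solve 4 (λ q x t e → q :* q :* (q :* q) :* (x :* x :* (x :* x)) :* t :* (e :* e)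
            := x :* (x :* (x :* (x :* (t :* (q :* q :* (q :* q) :* (e :* e))))))) refl q x _ E ⟩
      x * (x * (x * (x * (quadratic q r y s x F * (q * q * (q * q) * (E * E)))))) ∎

-- Order of vanishing of a power series

module SeriesOrder {c ℓ} {R : CommutativeRing c ℓ} (O : SeriesOperations R) where

  private module R = CommutativeRing R
  open R using (0#; 1#)
  open SeriesOperations O
  open PowerSeries O public using (const-⊛; seriesRing; ⊛-cong; ⊛-zeroˡ; ⊛-identityˡ; ⊛-comm)
  module S = CommutativeRing seriesRing
  open S using () renaming (_≈_ to _≋_)

  X-⊛-zero : ∀ f → (X ⊛ f) 0 R.≈ 0#
  X-⊛-zero f = R.trans (⊛-zero X f) (R.trans (R.*-congʳ X-zero) (R.zeroˡ _))

  X-⊛-suc : ∀ f k → (X ⊛ f) (suc k) R.≈ f k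
  X-⊛-suc f k = begin
    (X ⊛ f) (suc k)                             ≈⟨ ⊛-suc X f k ⟩
    X 0 R.* f (suc k) R.+ ((X ∘ suc) ⊛ f) k     ≈⟨ R.+-cong (R.trans (R.*-congʳ X-zero) (R.zeroˡ _)) (⊛-cong X∘suc≋1 S.refl k) ⟩
    0# R.+ (const 1# ⊛ f) k                     ≈⟨ R.+-identityˡ _ ⟩
    (const 1# ⊛ f) k                            ≈⟨ ⊛-identityˡ f k ⟩
    f k                                         ∎
    where
    open import Relation.Binary.Reasoning.Setoid R.setoid
    X∘suc≋1 : X ∘ suc ≋ const 1#
    X∘suc≋1 zero    = R.trans X-one (R.sym (const-zero 1#))
    X∘suc≋1 (suc k) = R.trans (X-suc k) (R.sym (const-suc 1# k))

  const-cong : ∀ {a b} → a R.≈ b → const a ≋ const b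
  const-cong a≈b zero    = R.trans (const-zero _) (R.trans a≈b (R.sym (const-zero _)))
  const-cong a≈b (suc k) = R.trans (const-suc _ k) (R.sym (const-suc _ k))

  const-* : ∀ a b → const (a R.* b) ≋ const a ⊛ const b
  const-* a b zero    = R.trans (const-zero _) (R.sym (R.trans (const-⊛ a (const b) 0) (R.*-congˡ (const-zero b))))
  const-* a b (suc k) = R.trans (const-suc _ k)
    (R.sym (R.trans (const-⊛ a (const b) (suc k)) (R.trans (R.*-congˡ (const-suc b k)) (R.zeroʳ a))))

  const-+ : ∀ a b → const (a R.+ b) ≋ (const a S.+ const b)
  const-+ a b zero    = R.trans (const-zero _) (R.sym (R.+-cong (const-zero a) (const-zero b)))
  const-+ a b (suc k) = R.trans (const-suc _ k)
    (R.sym (R.trans (R.+-cong (const-suc a k) (const-suc b k)) (R.+-identityˡ 0#)))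

  const-neg : ∀ a → const (R.- a) ≋ S.- const a
  const-neg a zero    = R.trans (const-zero _) (R.sym (R.-‿cong (const-zero a)))
  const-neg a (suc k) = R.trans (const-suc _ k) (R.sym (R.trans (R.-‿cong (const-suc a k)) -0#≈0#))
    where open import Algebra.Properties.Ring R.ring using (-0#≈0#)

  -- Divisibility by the k-th power of `X`, expressed through coefficients.
  Ord : ℕ → S.Carrier → Set ℓ
  Ord k f = ∀ j → j < k → f j R.≈ 0#

  ord-cong : ∀ {k f g} → f ≋ g → Ord k f → Ord k g
  ord-cong f≋g o j j<k = R.trans (R.sym (f≋g j)) (o j j<k)

  ord-≤ : ∀ {k l f} → k ≤ l → Ord l f → Ord k f
  ord-≤ k≤l o j j<k = o j (ℕ.<-≤-trans j<k k≤l)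

  ord-+ : ∀ {k f g} → Ord k f → Ord k g → Ord k (f S.+ g)
  ord-+ o o′ j j<k = R.trans (R.+-cong (o j j<k) (o′ j j<k)) (R.+-identityˡ 0#)

  ord-neg : ∀ {k f} → Ord k f → Ord k (S.- f)
  ord-neg o j j<k = R.trans (R.-‿cong (o j j<k)) -0#≈0#
    where open import Algebra.Properties.Ring R.ring using (-0#≈0#)

  ord-* : ∀ {k f} g → Ord k f → Ord k (f ⊛ g)
  ord-* {_} {f} g o zero    j<k = R.trans (⊛-zero f g) (R.trans (R.*-congʳ (o 0 j<k)) (R.zeroˡ _))
  ord-* {suc k} {f} g o (suc j) (s≤s j<k) = R.trans (⊛-suc f g j) (R.trans
    (R.+-cong (R.trans (R.*-congʳ (o 0 (s≤s z≤n))) (R.zeroˡ _)) (ord-* {k} {f ∘ suc} g (λ i i<k → o (suc i) (s≤s i<k)) j j<k))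
    (R.+-identityˡ 0#))

  ord-*ˡ : ∀ {k f} g → Ord k f → Ord k (g ⊛ f)
  ord-*ˡ {_} {f} g o = ord-cong (⊛-comm f g) (ord-* g o)

  ord-X : ∀ {k f} → Ord k f → Ord (suc k) (X ⊛ f)
  ord-X {f = f} o zero    _         = X-⊛-zero f
  ord-X {f = f} o (suc j) (s≤s j<k) = R.trans (X-⊛-suc f j) (o j j<k)

-- Convergence to the unique root

module Approximation {c ℓ} {R : CommutativeRing c ℓ} (O : SeriesOperations R) where

  private module R = CommutativeRing R
  open R using (Carrier; _≈_; _+_; _*_; -_; _-_; 0#; 1#)
  open SeriesOperations O
  open SeriesOrder O
  open S using () renaming (_≈_ to _≋_)
  open QuadraticIdentities seriesRing
  open IntegerCoefficientSolver seriesRing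
  open import Relation.Binary.Reasoning.Setoid S.setoid
  open import Algebra.Properties.Ring S.ring using (x≈y⇒x∙y⁻¹≈ε; x∙y⁻¹≈ε⇒x≈y)

  module Limit (s y : Carrier) (α α⁻¹ : ℕ → Carrier)
    (α-rec : ∀ n → α (suc (suc n)) ≈ - (y * α (suc n)) - α n)
    (α-inv : ∀ n → α (suc n) * α⁻¹ n ≈ 1#) where

    ᾱ : ℕ → S.Carrier
    ᾱ n = const (α n)

    Q : ℕ → S.Carrier → S.Carrier
    Q n = quadratic (ᾱ n) (ᾱ (suc n)) (const y) (const s) X

    private
      slope : ℕ → S.Carrier → S.Carrier
      slope n h = leading (ᾱ n) (ᾱ (suc n)) (const y) (const s) X ⊛ h S.+ middle (ᾱ n) (ᾱ (suc n)) (const y) (const s) X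

      ᾱ-inv : ∀ n → ᾱ (suc n) ⊛ const (α⁻¹ n) ≋ S.1#
      ᾱ-inv n = S.trans (S.sym (const-* (α (suc n)) (α⁻¹ n))) (const-cong (α-inv n))

      ᾱ-rec : ∀ n → ᾱ (suc (suc n)) ≋ S.- (const y ⊛ ᾱ (suc n)) S.- ᾱ n
      ᾱ-rec n = begin
        const (α (suc (suc n)))                        ≈⟨ const-cong (α-rec n) ⟩
        const (- (y * α (suc n)) - α n)                ≈⟨ const-+ _ _ ⟩
        const (- (y * α (suc n))) S.+ const (- α n)    ≈⟨ S.+-cong (const-neg _) (const-neg _) ⟩
        S.- const (y * α (suc n)) S.- ᾱ n              ≈⟨ S.+-congʳ (S.-‿cong (const-* y (α (suc n)))) ⟩
        S.- (const y ⊛ ᾱ (suc n)) S.- ᾱ n              ∎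

    -- With δ = f - g, the factorisation Q f - Q g = δ (X h - q²) rearranges to δ = q⁻² (X δ h - (Q
    -- f - Q g)). On the right δ carries a factor X, so whatever order is known for δ improves by
    -- one.
    ord-difference-step : ∀ n f g j → Ord (suc j) (Q n f S.- Q n g) → Ord j (f S.- g) → Ord (suc j) (f S.- g)
    ord-difference-step n f g j oQ oδ = ord-cong (S.sym δ-eq)
      (ord-*ˡ _ (ord-+ (ord-X (ord-* h oδ)) (ord-neg oQ)))
      where
      p = ᾱ n
      q = ᾱ (suc n)
      q⁻¹ = const (α⁻¹ n)
      δ = f S.- g
      ȳ = const y
      s̄ = const s
      h = ((q ⊛ q S.+ ȳ ⊛ p ⊛ q S.+ p ⊛ p) ⊛ (X ⊛ X ⊛ X) S.- s̄ ⊛ (p ⊛ q) ⊛ (X ⊛ X) S.+ p ⊛ q ⊛ X) ⊛ (f S.+ g)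
        S.+ (S.- (ȳ ⊛ (q ⊛ q)) S.- (S.1# S.+ S.1#) ⊛ (p ⊛ q)) ⊛ X S.+ s̄ ⊛ (q ⊛ q)
      Q-eq : Q n f S.- Q n g ≋ δ ⊛ (X ⊛ h S.- q ⊛ q)
      Q-eq = S.trans (quadratic-difference p q ȳ s̄ X f g) (S.*-congˡ (quadratic-slope p q ȳ s̄ X (f S.+ g)))
      δ-eq : δ ≋ q⁻¹ ⊛ q⁻¹ ⊛ (X ⊛ (δ ⊛ h) S.- (Q n f S.- Q n g))
      δ-eq = begin
        δ                                                 ≈⟨ solve 1 (λ d → d := con (+ 1) :* con (+ 1) :* d) S.refl δ ⟩
        S.1# ⊛ S.1# ⊛ δ                                   ≈⟨ S.*-congʳ (S.*-cong (ᾱ-inv n) (ᾱ-inv n)) ⟨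
        q ⊛ q⁻¹ ⊛ (q ⊛ q⁻¹) ⊛ δ
          ≈⟨ solve 5 (λ q i d x h → q :* i :* (q :* i) :* d := i :* i :* (x :* (d :* h) :- d :* (x :* h :- q :* q))) S.refl q q⁻¹ δ X h ⟩
        q⁻¹ ⊛ q⁻¹ ⊛ (X ⊛ (δ ⊛ h) S.- δ ⊛ (X ⊛ h S.- q ⊛ q)) ≈⟨ S.*-congˡ (S.+-congˡ (S.-‿cong Q-eq)) ⟨
        q⁻¹ ⊛ q⁻¹ ⊛ (X ⊛ (δ ⊛ h) S.- (Q n f S.- Q n g))   ∎

    ord-difference : ∀ n f g k → Ord k (Q n f S.- Q n g) → Ord k (f S.- g)
    ord-difference n f g zero    oQ j ()
    ord-difference n f g (suc k) oQ = ord-difference-step n f g k oQ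
      (ord-difference n f g k (ord-≤ (ℕ.n≤1+n k) oQ))

    ord-difference⇒ord-quadratic : ∀ n f g k → Ord k (f S.- g) → Ord k (Q n f S.- Q n g)
    ord-difference⇒ord-quadratic n f g k o =
      ord-cong (S.sym (quadratic-difference (ᾱ n) (ᾱ (suc n)) (const y) (const s) X f g)) (ord-* (slope n (f S.+ g)) o)

    -- The difference of two roots vanishes to every order; coefficient k is settled by order k + 1.
    root-unique : ∀ n {f g} → Q n f ≋ S.0# → Q n g ≋ S.0# → f ≋ g
    root-unique n {f} {g} Qf≋0 Qg≋0 =
      x∙y⁻¹≈ε⇒x≈y f g (λ k → ord-difference n f g (suc k)
        (λ j _ → x≈y⇒x∙y⁻¹≈ε (S.trans Qf≋0 (S.sym Qg≋0)) j) k ℕ.≤-refl)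

    -- `T n m` is the fraction that starts at α_n, cut off after m levels, and `G n m` is the tail
    -- of `T n (suc (suc m))` below its first level. Each level is given as an equation with its
    -- denominator, so that no inverse of a series appears.
    record IsConvergents (T : ℕ → ℕ → S.Carrier) : Set (c ⊔ ℓ) where
      field
        G       : ℕ → ℕ → S.Carrier
        T-zero  : ∀ n → T n 0 ≋ S.1#
        T-one   : ∀ n → T n 1 ⊛ (S.1# S.- const s ⊛ X S.- const (α (suc (suc n)) * α⁻¹ n) ⊛ (X ⊛ X)) ≋ S.1#
        T-suc   : ∀ n m → T n (suc (suc m)) ⊛
                    (S.1# S.- const s ⊛ X S.- const (α (suc (suc n)) * α⁻¹ n) ⊛ (X ⊛ X ⊛ G n m)) ≋ S.1#
        G-def   : ∀ n m → G n m ⊛ (S.1# S.- const (α (suc n) * α⁻¹ (suc n)) ⊛ (X ⊛ X ⊛ T (suc n) m)) ≋ S.1#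

    module _ {T : ℕ → ℕ → S.Carrier} (isConvergents : IsConvergents T) where
      open IsConvergents isConvergents

      -- Induction in steps of two: both the index n of the equation and the start of the fraction
      -- advance by one for every two levels removed.
      ord-quadratic-convergent : ∀ n m → Ord (suc m) (Q n (T n m))
      ord-quadratic-convergent n zero =
        ord-cong (S.sym (S.trans (quadratic-cong (T-zero n)) (quadratic-at-1 (ᾱ n) (ᾱ (suc n)) (const y) (const s) X)))
          (ord-X (λ _ ()))
      ord-quadratic-convergent n (suc zero) =
        ord-cong (S.sym (quadratic-at-first-convergent (T-one n))) (ord-X (ord-X (λ _ ())))
      ord-quadratic-convergent n (suc (suc m)) =
        -- Two more levels gain four orders; only two of them are kept, to match the claimed m + 1.
        ord-≤ (ℕ.≤-trans (ℕ.n≤1+n _) (ℕ.n≤1+n _))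
          (ord-cong (S.sym (quadratic-step (ᾱ-rec n) (ᾱ-inv n) (ᾱ-inv (suc n))
              (const-cancel (α (suc (suc n))) (α-inv n)) (const-cancel (α (suc n)) (α-inv (suc n))) (T-suc n m) (G-def n m)))
            (ord-X (ord-X (ord-X (ord-X (ord-* _ (ord-quadratic-convergent (suc n) m)))))))
        where
        const-cancel : ∀ a {b b⁻¹} → b * b⁻¹ ≈ 1# → const (a * b⁻¹) ⊛ const b ≋ const a
        const-cancel a {b} {b⁻¹} bb⁻¹≈1 = S.trans (S.sym (const-* (a * b⁻¹) b)) (const-cong
          (R.trans (R.*-assoc a b⁻¹ b) (R.trans (R.*-congˡ (R.trans (R.*-comm b⁻¹ b) bb⁻¹≈1)) (R.*-identityʳ a))))

      -- Both convergents nearly satisfy the same equation, hence they are close to each other.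
      convergents-stable : ∀ n {i j} → i ≤ j → Ord (suc i) (T n i S.- T n j)
      convergents-stable n {i} {j} i≤j = ord-difference n (T n i) (T n j) (suc i)
        (ord-+ (ord-quadratic-convergent n i) (ord-neg (ord-≤ (s≤s i≤j) (ord-quadratic-convergent n j))))

      -- For j ≤ k the series `T n j` and `T n k` agree through degree j, so the diagonal J agrees
      -- with `T n k` through degree k. Then Q J and Q (T n k) agree there too, and the latter
      -- vanishes to order k + 1.
      limit-isRoot : ∀ n {J} → (∀ k → J k ≈ T n k k) → Q n J ≋ S.0#
      limit-isRoot n {J} J-def k = R.trans (R.sym (split k))
        (ord-+ (ord-difference⇒ord-quadratic n J (T n k) (suc k) J-near) (ord-quadratic-convergent n k) k ℕ.≤-refl)
        where
        J-near : Ord (suc k) (J S.- T n k)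
        J-near j (s≤s j≤k) = R.trans (R.+-congʳ (J-def j)) (convergents-stable n j≤k j ℕ.≤-refl)
        split : (Q n J S.- Q n (T n k)) S.+ Q n (T n k) ≋ Q n J
        split = solve 2 (λ a b → (a :- b) :+ b := a) S.refl (Q n J) (Q n (T n k))

-- Generating functions

-- The index is shifted: shiftedα … n stands for α_{n-1}, with α_{-1} = -z obtained
-- by running the recurrence backwards.
shiftedα : ∀ {c} {C : Set c} (_+_ _*_ : C → C → C) (-_ : C → C) (1# y z : C) → ℕ → C
shiftedα _+_ _*_ -_ 1# y z 0 = - z
shiftedα _+_ _*_ -_ 1# y z 1 = 1#
shiftedα _+_ _*_ -_ 1# y z (suc (suc n)) =
  (- (y * shiftedα _+_ _*_ -_ 1# y z (suc n))) + (- shiftedα _+_ _*_ -_ 1# y z n)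

module GeneratingFunctions {c ℓ} {R : CommutativeRing c ℓ} (O : SeriesOperations R) where

  private module R = CommutativeRing R
  open R using (Carrier; _≈_; _+_; _*_; -_; _-_; 0#; 1#)
  open SeriesOperations O
  open SeriesOrder O
  open S using () renaming (_≈_ to _≋_)
  private
    module K-Solver = IntegerCoefficientSolver R
  open import Algebra.Properties.Ring R.ring using (-0#≈0#)

  coeffs : Carrier → Carrier → Carrier → ℕ → Carrier
  coeffs a b c 0 = a
  coeffs a b c 1 = b
  coeffs a b c 2 = c
  coeffs a b c (suc (suc (suc _))) = 0#

  quadratic-coeffs : ∀ a b c → const a S.+ const b ⊛ X S.+ const c ⊛ (X ⊛ X) ≋ coeffs a b c
  quadratic-coeffs a b c k = R.trans (R.+-cong (R.+-congˡ (const-⊛ b X k)) (const-⊛ c (X ⊛ X) k)) (at k)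
    where
    at : ∀ k → const a k + b * X k + c * (X ⊛ X) k ≈ coeffs a b c k
    at 0 = R.trans (R.+-cong (R.+-cong (const-zero a) (R.*-congˡ X-zero)) (R.*-congˡ (X-⊛-zero X)))
      (solve 3 (λ a b c → a :+ b :* con (+ 0) :+ c :* con (+ 0) := a) R.refl a b c)
      where open K-Solver
    at 1 = R.trans (R.+-cong (R.+-cong (const-suc a 0) (R.*-congˡ X-one)) (R.*-congˡ (R.trans (X-⊛-suc X 0) X-zero)))
      (solve 2 (λ b c → con (+ 0) :+ b :* con (+ 1) :+ c :* con (+ 0) := b) R.refl b c)
      where open K-Solver
    at 2 = R.trans (R.+-cong (R.+-cong (const-suc a 1) (R.*-congˡ (X-suc 0))) (R.*-congˡ (R.trans (X-⊛-suc X 1) X-one)))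
      (solve 2 (λ b c → con (+ 0) :+ b :* con (+ 0) :+ c :* con (+ 1) := c) R.refl b c)
      where open K-Solver
    at (suc (suc (suc k))) =
      R.trans (R.+-cong (R.+-cong (const-suc a (suc (suc k))) (R.*-congˡ (X-suc (suc k))))
                        (R.*-congˡ (R.trans (X-⊛-suc X (suc (suc k))) (X-suc k))))
      (solve 2 (λ b c → con (+ 0) :+ b :* con (+ 0) :+ c :* con (+ 0) := con (+ 0)) R.refl b c)
      where open K-Solver

  Δ : (ℕ → Carrier) → ℕ → Carrier
  Δ f zero    = f 0
  Δ f (suc k) = f (suc k) - f k

  ⊛-1-X : ∀ f → f ⊛ (S.1# S.- X) ≋ Δ f
  ⊛-1-X f k = R.trans (expand k) (at k)
    where
    expand : f ⊛ (S.1# S.- X) ≋ f S.- X ⊛ f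
    expand = solve 2 (λ f x → f :* (con (+ 1) :- x) := f :- x :* f) S.refl f X
      where open IntegerCoefficientSolver seriesRing
    at : ∀ k → f k - (X ⊛ f) k ≈ Δ f k
    at zero    = R.trans (R.+-congˡ (R.trans (R.-‿cong (X-⊛-zero f)) -0#≈0#)) (R.+-identityʳ _)
    at (suc k) = R.+-congˡ (R.-‿cong (X-⊛-suc f k))

  Θ : Carrier → (ℕ → Carrier) → ℕ → Carrier
  Θ c f 0 = f 0
  Θ c f 1 = f 1 + c * f 0
  Θ c f (suc (suc k)) = f (suc (suc k)) + c * f (suc k) + f k

  ⊛-1+cX+X² : ∀ c f → f ⊛ (S.1# S.+ const c ⊛ X S.+ X ⊛ X) ≋ Θ c f
  ⊛-1+cX+X² c f k = R.trans (expand k) (R.trans (R.+-congʳ (R.+-congˡ (const-⊛ c (X ⊛ f) k))) (at k))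
    where
    expand : f ⊛ (S.1# S.+ const c ⊛ X S.+ X ⊛ X) ≋ f S.+ const c ⊛ (X ⊛ f) S.+ X ⊛ (X ⊛ f)
    expand = solve 3 (λ f c x → f :* (con (+ 1) :+ c :* x :+ x :* x) := f :+ c :* (x :* f) :+ x :* (x :* f)) S.refl f (const c) X
      where open IntegerCoefficientSolver seriesRing
    at : ∀ k → f k + c * (X ⊛ f) k + (X ⊛ (X ⊛ f)) k ≈ Θ c f k
    at 0 = R.trans (R.+-cong (R.+-congˡ (R.*-congˡ (X-⊛-zero f))) (X-⊛-zero (X ⊛ f)))
      (solve 2 (λ f c → f :+ c :* con (+ 0) :+ con (+ 0) := f) R.refl (f 0) c)
      where open K-Solver
    at 1 = R.trans (R.+-cong (R.+-congˡ (R.*-congˡ (X-⊛-suc f 0))) (R.trans (X-⊛-suc (X ⊛ f) 0) (X-⊛-zero f)))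
      (R.+-identityʳ _)
    at (suc (suc k)) = R.+-cong (R.+-congˡ (R.*-congˡ (X-⊛-suc f (suc k))))
      (R.trans (X-⊛-suc (X ⊛ f) (suc k)) (X-⊛-suc f k))

  Θ-cong : ∀ c {f g} → f ≋ g → Θ c f ≋ Θ c g
  Θ-cong c f≋g 0 = f≋g 0
  Θ-cong c f≋g 1 = R.+-cong (f≋g 1) (R.*-congˡ (f≋g 0))
  Θ-cong c f≋g (suc (suc k)) = R.+-cong (R.+-cong (f≋g (suc (suc k))) (R.*-congˡ (f≋g (suc k)))) (f≋g k)

  -- Multiplication by the common denominator becomes a difference operator. A candidate for the
  -- quotient is then checked on three initial coefficients and a recurrence.
  ⊛-[1-X][1+cX+X²] : ∀ c f → f ⊛ ((S.1# S.- X) ⊛ (S.1# S.+ const c ⊛ X S.+ X ⊛ X)) ≋ Θ c (Δ f)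
  ⊛-[1-X][1+cX+X²] c f = S.trans (S.sym (S.*-assoc f _ _))
    (S.trans (⊛-1+cX+X² c (f ⊛ (S.1# S.- X))) (Θ-cong c (⊛-1-X f)))

  module Recurrence (y z : Carrier) where
    open K-Solver

    α : ℕ → Carrier
    α = shiftedα _+_ _*_ -_ 1# y z

    recurrence : ∀ k → Θ y α (suc (suc k)) ≈ 0#
    recurrence k = solve 3 (λ y q p → :- (y :* q) :- p :+ y :* q :+ p := con (+ 0)) R.refl y (α (suc k)) (α k)

    α-generating : (α ∘ suc) ⊛ (S.1# S.+ const y ⊛ X S.+ X ⊛ X) ≋
      const 1# S.+ const z ⊛ X S.+ const 0# ⊛ (X ⊛ X)
    α-generating k = R.trans (⊛-1+cX+X² y (α ∘ suc) k) (R.trans (at k) (R.sym (quadratic-coeffs 1# z 0# k)))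
      where
      at : ∀ k → Θ y (α ∘ suc) k ≈ coeffs 1# z 0# k
      at 0 = R.refl
      at 1 = solve 2 (λ y z → :- (y :* con (+ 1)) :- (:- z) :+ y :* con (+ 1) := z) R.refl y z
      at 2 = recurrence 1
      at (suc (suc (suc k))) = recurrence (suc (suc k))

    -- If λ and 1/λ are the roots of t² + y t + 1, products of two terms of α at a fixed distance
    -- are combinations of λ^(2n), λ^(-2n) and 1, and λ² + λ^(-2) = y² - 2. This is why (1 - x)(1 -
    -- (y² - 2) x + x²) serves for all of them.
    c₀ : Carrier
    c₀ = - (y * y - (1# + 1#))

    -- q² + y p q + p² is an invariant of the recurrence.
    a-invariant : ∀ n → α (suc n) * α (suc n) + y * α n * α (suc n) + α n * α n ≈ 1# - y * z + z * z
    a-invariant zero = solve 2 (λ y z → con (+ 1) :* con (+ 1) :+ y :* (:- z) :* con (+ 1) :+ (:- z) :* (:- z)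
      := con (+ 1) :- y :* z :+ z :* z) R.refl y z
    a-invariant (suc n) = R.trans (solve 3 (λ y p q → let r = :- (y :* q) :- p in
      r :* r :+ y :* q :* r :+ q :* q := q :* q :+ y :* p :* q :+ p :* p) R.refl y (α n) (α (suc n))) (a-invariant n)

    b d : ℕ → Carrier
    b n = α n * α (suc n)
    d n = - (α (suc n) * α (suc n))

    -- The quadratic factor cancels in the series of a_n, which leaves e / (1 - x), the series of a
    -- constant sequence.
    a-generating : ∀ e → (λ _ → e) ⊛ ((S.1# S.- X) ⊛ (S.1# S.+ const c₀ ⊛ X S.+ X ⊛ X)) ≋
      const e ⊛ (S.1# S.+ const c₀ ⊛ X S.+ X ⊛ X)
    a-generating e = S.trans (S.sym (S.*-assoc _ _ _)) (S.*-congʳ (S.trans (⊛-1-X (λ _ → e)) at))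
      where
      at : Δ (λ _ → e) ≋ const e
      at zero    = R.sym (const-zero e)
      at (suc k) = R.trans (R.-‿inverseʳ e) (R.sym (const-suc e k))

    b-generating : b ⊛ ((S.1# S.- X) ⊛ (S.1# S.+ const c₀ ⊛ X S.+ X ⊛ X)) ≋
      const (- z) S.+ const (y * (y * z - 1#)) ⊛ X S.+ const (- (z * (y * z - 1#))) ⊛ (X ⊛ X)
    b-generating k = R.trans (⊛-[1-X][1+cX+X²] c₀ b k) (R.trans (at k) (R.sym (quadratic-coeffs _ _ _ k)))
      where
      at : ∀ k → Θ c₀ (Δ b) k ≈ coeffs (- z) (y * (y * z - 1#)) (- (z * (y * z - 1#))) k
      at 0 = R.*-identityʳ _
      at 1 = solve 2 (λ y z → let p = :- z; q = con (+ 1); r = :- (y :* q) :- p; c = :- (y :* y :- con (+ 2)) in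
        (q :* r :- p :* q) :+ c :* (p :* q) := y :* (y :* z :- con (+ 1))) R.refl y z
      at 2 = solve 2 (λ y z → let p = :- z; q = con (+ 1); r = :- (y :* q) :- p; t = :- (y :* r) :- q; c = :- (y :* y :- con (+ 2)) in
        (r :* t :- q :* r) :+ c :* (q :* r :- p :* q) :+ p :* q := :- (z :* (y :* z :- con (+ 1)))) R.refl y z
      -- Beyond the numerator every term unrolls to a polynomial in two consecutive values p and q,
      -- and the combination vanishes identically.
      at (suc (suc (suc k))) = solve 3 (λ y p q → let r = :- (y :* q) :- p; t = :- (y :* r) :- q; u = :- (y :* t) :- r; c = :- (y :* y :- con (+ 2)) in
        (t :* u :- r :* t) :+ c :* (r :* t :- q :* r) :+ (q :* r :- p :* q) := con (+ 0)) R.refl y (α k) (α (suc k))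

    d-generating : d ⊛ ((S.1# S.- X) ⊛ (S.1# S.+ const c₀ ⊛ X S.+ X ⊛ X)) ≋
      const (- 1#) S.+ const (- (1# + z * z - (1# + 1#) * y * z)) ⊛ X S.+ const (- (z * z)) ⊛ (X ⊛ X)
    d-generating k = R.trans (⊛-[1-X][1+cX+X²] c₀ d k) (R.trans (at k) (R.sym (quadratic-coeffs _ _ _ k)))
      where
      at : ∀ k → Θ c₀ (Δ d) k ≈ coeffs (- 1#) (- (1# + z * z - (1# + 1#) * y * z)) (- (z * z)) k
      at 0 = R.-‿cong (R.*-identityʳ _)
      at 1 = solve 2 (λ y z → let p = :- z; q = con (+ 1); r = :- (y :* q) :- p; c = :- (y :* y :- con (+ 2)) in
        ((:- (r :* r)) :- (:- (q :* q))) :+ c :* (:- (q :* q)) := :- (con (+ 1) :+ z :* z :- con (+ 2) :* y :* z)) R.refl y z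
      at 2 = solve 2 (λ y z → let p = :- z; q = con (+ 1); r = :- (y :* q) :- p; t = :- (y :* r) :- q; c = :- (y :* y :- con (+ 2)) in
        ((:- (t :* t)) :- (:- (r :* r))) :+ c :* ((:- (r :* r)) :- (:- (q :* q))) :+ (:- (q :* q)) := :- (z :* z)) R.refl y z
      at (suc (suc (suc k))) = solve 3 (λ y p q → let r = :- (y :* q) :- p; t = :- (y :* r) :- q; u = :- (y :* t) :- r; c = :- (y :* y :- con (+ 2)) in
        ((:- (u :* u)) :- (:- (t :* t))) :+ c :* ((:- (t :* t)) :- (:- (r :* r))) :+ ((:- (r :* r)) :- (:- (q :* q))) := con (+ 0)) R.refl y (α k) (α (suc k))

-- The operations are known only through their defining equations, so that the
-- arithmetic of K is never unfolded in the proof.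
record Setting : Set₁ where
  field
    R : CommutativeRing Level.zero Level.zero
  open CommutativeRing R public using (_≈_; _+_; _*_; -_; 0#; 1#) renaming (Carrier to C)
  infixl 6 _-_ _+ₛ_ _-ₛ_
  infixl 7 _/_ _*ₛ_ _/ₛ_
  infix 8 _·ₛ_
  field
    _-_ _/_ : C → C → C
    inv : C → C
    sub-def : ∀ a b → a - b ≡ a + (- b)
    div-def : ∀ a b → a / b ≡ a * inv b
    inv-inverse : ∀ a → ¬ a ≈ 0# → a * inv a ≈ 1#
    _+ₛ_ _-ₛ_ _*ₛ_ _/ₛ_ : (ℕ → C) → (ℕ → C) → (ℕ → C)
    _·ₛ_ : C → (ℕ → C) → (ℕ → C)
    const : C → ℕ → C
    invₛ : (ℕ → C) → (ℕ → C)
    +ₛ-def : ∀ f g k → (f +ₛ g) k ≡ f k + g k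
    -ₛ-def : ∀ f g k → (f -ₛ g) k ≡ f k + (- g k)
    *ₛ-zero : ∀ f g → (f *ₛ g) 0 ≡ f 0 * g 0 + 0#
    *ₛ-suc : ∀ f g k → (f *ₛ g) (suc k) ≡ f 0 * g (suc k) + ((f ∘ suc) *ₛ g) k
    /ₛ-def : ∀ f g → f /ₛ g ≡ f *ₛ invₛ g
    ·ₛ-def : ∀ c f k → (c ·ₛ f) k ≡ c * f k
    const-zero : ∀ c → const c 0 ≡ c
    const-suc : ∀ c k → const c (suc k) ≡ 0#
    invₛ-inverse : ∀ f → ¬ f 0 ≈ 0# → ∀ k → (f *ₛ invₛ f) k ≈ const 1# k
    1ₛ xₛ x2 x3 x4 : ℕ → C
    1ₛ-def : 1ₛ ≡ const 1#
    xₛ-zero : xₛ 0 ≡ 0#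
    xₛ-one : xₛ 1 ≡ 1#
    xₛ-suc : ∀ k → xₛ (suc (suc k)) ≡ 0#
    x2-def : x2 ≡ xₛ *ₛ xₛ
    x3-def : x3 ≡ x2 *ₛ xₛ
    x4-def : x4 ≡ x3 *ₛ xₛ
    s y z two y²-two : C
    two-def : two ≡ 1# + 1#
    y²-two-def : y²-two ≡ y * y - two
    α≉0 : ∀ n → ¬ shiftedα _+_ _*_ -_ 1# y z (suc n) ≈ 0#
    quad den as bs ds αs : ℕ → C
    quad-def : quad ≡ 1ₛ -ₛ y²-two ·ₛ xₛ +ₛ x2
    den-def : den ≡ (1ₛ -ₛ xₛ) *ₛ quad
    as-def : as ≡ ((1# - y * z) + z * z) ·ₛ quad /ₛ den
    bs-def : bs ≡ ((- z) ·ₛ 1ₛ +ₛ (y * (y * z - 1#)) ·ₛ xₛ -ₛ (z * (y * z - 1#)) ·ₛ x2) /ₛ den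
    ds-def : ds ≡ ((- 1#) ·ₛ 1ₛ -ₛ ((1# + z * z) - two * y * z) ·ₛ xₛ -ₛ (z * z) ·ₛ x2) /ₛ den
    αs-def : αs ≡ (1ₛ +ₛ z ·ₛ xₛ) /ₛ (1ₛ +ₛ y ·ₛ xₛ +ₛ x2)
    u : ℕ → C
    v : ℕ → ℕ → C
    u-one : u 1 ≡ - s
    u-two : u 2 ≡ 0#
    u-period : ∀ j → u (suc (suc (suc j))) ≡ u (suc j)
    v-zero : ∀ n → v n 0 ≡ 1#
    v-one : ∀ n → v n 1 ≡ αs (suc n) / αs n
    v-two : ∀ n → v n 2 ≡ αs n / αs (suc n)
    v-shift : ∀ n j → v n (suc (suc (suc j))) ≡ v (suc n) (suc j)
    tail : (u v : ℕ → C) → ℕ → ℕ → ℕ → C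
    jFrac : (u v : ℕ → C) → ℕ → C
    tail-zero : ∀ u v i → tail u v 0 i ≡ 1ₛ
    tail-suc : ∀ u v m i → tail u v (suc m) i ≡
      invₛ (1ₛ +ₛ u (suc i) ·ₛ xₛ -ₛ v (suc i) ·ₛ (xₛ *ₛ xₛ *ₛ tail u v m (suc i)))
    jFrac-def : ∀ u v k → jFrac u v k ≡ v 0 * tail u v k 0 k

-- The series and the J-fraction of the statement, over abstract operations

module JFractionTheorem (setting : Setting) where

  open Setting setting
  private module R = CommutativeRing R

  O : SeriesOperations R
  O = record
    { _⊛_ = _*ₛ_
    ; ⊛-zero = λ f g → R.trans (R.reflexive (*ₛ-zero f g)) (R.+-identityʳ _)
    ; ⊛-suc = λ f g k → R.reflexive (*ₛ-suc f g k)
    ; const = const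
    ; const-zero = λ c → R.reflexive (const-zero c)
    ; const-suc = λ c k → R.reflexive (const-suc c k)
    ; X = xₛ ; X-zero = R.reflexive xₛ-zero ; X-one = R.reflexive xₛ-one ; X-suc = λ k → R.reflexive (xₛ-suc k) }

  open SeriesOrder O
  open GeneratingFunctions O
  open Recurrence y z
  open S using () renaming (_≈_ to _≋_)
  open SeriesOperations O using (_⊛_)
  private module ≋-Reasoning = Relation.Binary.Reasoning.Setoid S.setoid

  +ₛ-cong : ∀ {f f′ g g′} → f ≋ f′ → g ≋ g′ → (f +ₛ g) ≋ (f′ S.+ g′)
  +ₛ-cong {f} {f′} {g} {g′} p q k = R.trans (R.reflexive (+ₛ-def f g k)) (R.+-cong (p k) (q k))

  -ₛ-cong : ∀ {f f′ g g′} → f ≋ f′ → g ≋ g′ → (f -ₛ g) ≋ (f′ S.- g′)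
  -ₛ-cong {f} {f′} {g} {g′} p q k = R.trans (R.reflexive (-ₛ-def f g k)) (R.+-cong (p k) (R.-‿cong (q k)))

  -- Scalars become constant series, after which everything is an equation in the single ring of
  -- series.
  ·ₛ-cong : ∀ {c c′ f g} → const c ≋ c′ → f ≋ g → (c ·ₛ f) ≋ (c′ ⊛ g)
  ·ₛ-cong {c} {c′} {f} {g} p q k = R.trans (R.reflexive (·ₛ-def c f k)) (R.trans (R.sym (const-⊛ c f k)) (S.*-cong p q k))

  1ₛ≋1 : 1ₛ ≋ S.1#
  1ₛ≋1 = S.reflexive 1ₛ-def

  x2≋ : x2 ≋ xₛ ⊛ xₛ
  x2≋ = S.reflexive x2-def

  x3≋ : x3 ≋ xₛ ⊛ xₛ ⊛ xₛ
  x3≋ = S.trans (S.reflexive x3-def) (S.*-congʳ x2≋)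

  x4≋ : x4 ≋ xₛ ⊛ xₛ ⊛ xₛ ⊛ xₛ
  x4≋ = S.trans (S.reflexive x4-def) (S.*-congʳ x3≋)

  sub≈ : ∀ {a a′ b b′} → a R.≈ a′ → b R.≈ b′ → (a - b) R.≈ (a′ R.- b′)
  sub≈ {a} {_} {b} p q = R.trans (R.reflexive (sub-def a b)) (R.+-cong p (R.-‿cong q))

  const-- : ∀ a b → const (a - b) ≋ const a S.- const b
  const-- a b = S.trans (const-cong (R.reflexive (sub-def a b))) (S.trans (const-+ a (- b)) (S.+-congˡ (const-neg b)))

  -- Identifies a quotient by multiplying a guess e back with the denominator.
  quotient-unique : ∀ {f g h e} → ¬ (g 0 R.≈ 0#) → f ≡ (h /ₛ g) → e ⊛ g ≋ h → f ≋ e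
  quotient-unique {f} {g} {h} {e} g₀≉0 f-def eg≋h = begin
    f                   ≡⟨ ≡.trans f-def (/ₛ-def h g) ⟩
    h ⊛ invₛ g          ≈⟨ S.*-congʳ eg≋h ⟨
    e ⊛ g ⊛ invₛ g      ≈⟨ S.*-assoc e g (invₛ g) ⟩
    e ⊛ (g ⊛ invₛ g)    ≈⟨ S.*-congˡ (invₛ-inverse g g₀≉0) ⟩
    e ⊛ const 1#        ≈⟨ S.*-identityʳ e ⟩
    e                   ∎
    where open ≋-Reasoning

  1≉0 : ¬ (1# R.≈ 0#)
  -- α_0 is 1 by definition.
  1≉0 = α≉0 0

  monic≉0 : ∀ {f g} → f ≋ g → g 0 R.≈ 1# → ¬ (f 0 R.≈ 0#)
  monic≉0 f≋g g₀≈1 f₀≈0 = 1≉0 (R.trans (R.sym g₀≈1) (R.trans (R.sym (f≋g 0)) f₀≈0))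

  -- Every series that has to be inverted is brought to this shape, which shows that its constant
  -- term is 1.
  1+cX+gX² : ∀ a g → (S.1# S.+ a ⊛ xₛ S.+ xₛ ⊛ g) 0 R.≈ 1#
  1+cX+gX² a g = R.trans (R.+-cong (R.+-cong (R.reflexive (const-zero 1#))
      (R.trans (⊛-comm a xₛ 0) (X-⊛-zero a))) (X-⊛-zero g))
    (R.trans (R.+-identityʳ _) (R.+-identityʳ _))

  quad≋ : quad ≋ S.1# S.+ const c₀ ⊛ xₛ S.+ xₛ ⊛ xₛ
  quad≋ = S.trans (S.reflexive quad-def) (+ₛ-cong (S.trans (-ₛ-cong 1ₛ≋1 (·ₛ-cong S.refl S.refl)) (S.+-congˡ neg)) x2≋)
    where
    open import Algebra.Properties.Ring S.ring using (-‿distribˡ-*)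
    neg : S.- (const y²-two ⊛ xₛ) ≋ const c₀ ⊛ xₛ
    neg = S.trans (-‿distribˡ-* _ _) (S.*-congʳ (S.trans (S.sym (const-neg y²-two)) (const-cong (R.-‿cong
      (R.trans (R.reflexive y²-two-def) (sub≈ R.refl (R.reflexive two-def)))))))

  den≋ : den ≋ (S.1# S.- xₛ) ⊛ (S.1# S.+ const c₀ ⊛ xₛ S.+ xₛ ⊛ xₛ)
  den≋ = S.trans (S.reflexive den-def) (S.*-cong (-ₛ-cong 1ₛ≋1 S.refl) quad≋)

  den₀≉0 : ¬ (den 0 R.≈ 0#)
  den₀≉0 = monic≉0 (S.trans den≋ expand) (1+cX+gX² _ _)
    where
    open IntegerCoefficientSolver seriesRing
    expand : (S.1# S.- xₛ) ⊛ (S.1# S.+ const c₀ ⊛ xₛ S.+ xₛ ⊛ xₛ) ≋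
      S.1# S.+ (const c₀ S.- S.1#) ⊛ xₛ S.+ xₛ ⊛ (xₛ S.- const c₀ ⊛ xₛ S.- xₛ ⊛ xₛ)
    expand = solve 2 (λ c x → (con (+ 1) :- x) :* (con (+ 1) :+ c :* x :+ x :* x)
      := con (+ 1) :+ (c :- con (+ 1)) :* x :+ x :* (x :- c :* x :- x :* x)) S.refl (const c₀) xₛ

  αs≈ : ∀ n → αs n R.≈ α (suc n)
  αs≈ = quotient-unique (monic≉0 den≋α (1+cX+gX² _ _)) αs-def
    (S.trans (S.*-congˡ den≋α) (S.trans α-generating (S.sym numerator)))
    where
    den≋α : ((1ₛ +ₛ (y ·ₛ xₛ)) +ₛ x2) ≋ S.1# S.+ const y ⊛ xₛ S.+ xₛ ⊛ xₛ
    den≋α = +ₛ-cong (+ₛ-cong 1ₛ≋1 (·ₛ-cong S.refl S.refl)) x2≋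
    numerator : (1ₛ +ₛ (z ·ₛ xₛ)) ≋ const 1# S.+ const z ⊛ xₛ S.+ const 0# ⊛ (xₛ ⊛ xₛ)
    numerator = S.trans (+ₛ-cong 1ₛ≋1 (·ₛ-cong S.refl S.refl)) (S.sym (S.trans
      (S.+-congˡ (λ k → R.trans (const-⊛ 0# (xₛ ⊛ xₛ) k) (R.zeroˡ _))) (S.+-identityʳ _)))

  as≈ : ∀ n → as n R.≈ (α (suc n) R.* α (suc n) R.+ y R.* α n R.* α (suc n) R.+ α n R.* α n)
  as≈ n = R.trans (quotient-unique den₀≉0 as-def (S.trans (S.*-congˡ den≋) (S.trans (a-generating _) (S.sym
      (·ₛ-cong S.refl quad≋)))) n)
    (R.trans (R.+-congʳ (R.reflexive (sub-def 1# (y * z)))) (R.sym (a-invariant n)))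

  bs≈ : ∀ n → bs n R.≈ (α n R.* α (suc n))
  bs≈ = quotient-unique den₀≉0 bs-def (S.trans (S.*-congˡ den≋) (S.trans b-generating (S.sym numerator)))
    where
    open import Algebra.Properties.Ring S.ring using (-‿distribˡ-*)
    numerator : ((((- z) ·ₛ 1ₛ) +ₛ ((y * ((y * z) - 1#)) ·ₛ xₛ)) -ₛ ((z * ((y * z) - 1#)) ·ₛ x2)) ≋
      const (- z) S.+ const (y R.* (y R.* z R.- 1#)) ⊛ xₛ S.+ const (R.- (z R.* (y R.* z R.- 1#))) ⊛ (xₛ ⊛ xₛ)
    numerator = S.trans
      (-ₛ-cong (+ₛ-cong (·ₛ-cong S.refl 1ₛ≋1) (·ₛ-cong (const-cong (R.*-congˡ (sub≈ R.refl R.refl))) S.refl))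
               (·ₛ-cong (const-cong (R.*-congˡ (sub≈ R.refl R.refl))) x2≋))
      (S.+-cong (S.+-congʳ (S.*-identityʳ _)) (S.trans (-‿distribˡ-* _ _) (S.*-congʳ (S.sym (const-neg _)))))

  ds≈ : ∀ n → ds n R.≈ R.- (α (suc n) R.* α (suc n))
  ds≈ = quotient-unique den₀≉0 ds-def (S.trans (S.*-congˡ den≋) (S.trans d-generating (S.sym numerator)))
    where
    open import Algebra.Properties.Ring S.ring using (-‿distribˡ-*)
    numerator : ((((- 1#) ·ₛ 1ₛ) -ₛ (((1# + (z * z)) - ((two * y) * z)) ·ₛ xₛ)) -ₛ ((z * z) ·ₛ x2)) ≋
      const (- 1#) S.+ const (R.- (1# R.+ z R.* z R.- (1# R.+ 1#) R.* y R.* z)) ⊛ xₛ S.+ const (R.- (z R.* z)) ⊛ (xₛ ⊛ xₛ)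
    numerator = S.trans
      (-ₛ-cong (-ₛ-cong (·ₛ-cong S.refl 1ₛ≋1) (·ₛ-cong (const-cong (sub≈ R.refl (R.*-congʳ (R.*-congʳ (R.reflexive two-def))))) S.refl))
               (·ₛ-cong S.refl x2≋))
      (S.+-cong (S.+-cong (S.*-identityʳ _) (S.trans (-‿distribˡ-* _ _) (S.*-congʳ (S.sym (const-neg _)))))
                (S.trans (-‿distribˡ-* _ _) (S.*-congʳ (S.sym (const-neg _)))))

  -- Taken from `αs` itself, so that it occurs literally in the quotients of `v`; `Setting` offers
  -- no congruence for `inv`.
  α⁻¹ : ℕ → C
  α⁻¹ n = inv (αs n)

  αs≉0 : ∀ n → ¬ (αs n R.≈ 0#)
  αs≉0 n αs≈0 = α≉0 n (R.trans (R.sym (αs≈ n)) αs≈0)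

  α-inv : ∀ n → (α (suc n) R.* α⁻¹ n) R.≈ 1#
  α-inv n = R.trans (R.*-congʳ (R.sym (αs≈ n))) (inv-inverse (αs n) (αs≉0 n))

  α-rec : ∀ n → α (suc (suc n)) R.≈ R.- (y R.* α (suc n)) R.- α n
  α-rec n = R.refl

  open Approximation O
  open Limit s y α α⁻¹ α-rec α-inv

  FEqLHS : ℕ → (ℕ → C) → (ℕ → C)
  FEqLHS n f =
    ((((((as n ·ₛ x4) -ₛ ((s * bs n) ·ₛ x3)) +ₛ (bs n ·ₛ x2)) *ₛ f) *ₛ f)
      +ₛ ((((((y * ds n) - (two * bs n)) ·ₛ x2) -ₛ ((s * ds n) ·ₛ xₛ)) +ₛ const (ds n)) *ₛ f))

  -- With a_n, b_n and d_n expressed through α and scalars read as constant series, this is an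
  -- instance of `quadratic-equation`.
  FEqLHS≋ : ∀ n f → FEqLHS n f ≋ Q n f S.- ᾱ (suc n) ⊛ ᾱ (suc n)
  FEqLHS≋ n f = S.trans
    (+ₛ-cong
      (S.*-congʳ (S.*-congʳ (+ₛ-cong (-ₛ-cong (·ₛ-cong ā x4≋) (·ₛ-cong (times s b̄) x3≋)) (·ₛ-cong b̄ x2≋))))
      (S.*-congʳ (+ₛ-cong (-ₛ-cong (·ₛ-cong (S.trans (const-- _ _) (S.+-cong (times y d̄) (S.-‿cong 2b̄))) x2≋)
                                    (·ₛ-cong (times s d̄) S.refl)) d̄)))
    (quadratic-equation p q (const y) (const s) xₛ f)
    where
    open QuadraticIdentities seriesRing using (quadratic-equation)
    p = ᾱ n
    q = ᾱ (suc n)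
    times : ∀ c {e e′} → const e ≋ e′ → const (c * e) ≋ const c ⊛ e′
    times c {e} e≋ = S.trans (const-* c e) (S.*-congˡ e≋)
    ā : const (as n) ≋ q ⊛ q S.+ const y ⊛ p ⊛ q S.+ p ⊛ p
    ā = S.trans (const-cong (as≈ n)) (S.trans (const-+ _ _) (S.+-cong (S.trans (const-+ _ _)
          (S.+-cong (const-* _ _) (S.trans (const-* _ _) (S.*-congʳ (const-* _ _))))) (const-* _ _)))
    b̄ : const (bs n) ≋ p ⊛ q
    b̄ = S.trans (const-cong (bs≈ n)) (const-* _ _)
    d̄ : const (ds n) ≋ S.- (q ⊛ q)
    d̄ = S.trans (const-cong (ds≈ n)) (S.trans (const-neg _) (S.-‿cong (const-* _ _)))
    2b̄ : const (two * bs n) ≋ (S.1# S.+ S.1#) ⊛ (p ⊛ q)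
    2b̄ = S.trans (times two b̄) (S.*-congʳ (S.trans (const-cong (R.reflexive two-def)) (const-+ 1# 1#)))

  -q²≋ds : ∀ n → const (ds n) ≋ S.- (ᾱ (suc n) ⊛ ᾱ (suc n))
  -q²≋ds n = S.trans (const-cong (ds≈ n)) (S.trans (const-neg _) (S.-‿cong (const-* _ _)))

  FEq⇒root : ∀ n f → FEqLHS n f ≋ const (ds n) → Q n f ≋ S.0#
  FEq⇒root n f h = begin
    Q n f                             ≈⟨ solve 2 (λ a b → a := (a :- b) :+ b) S.refl (Q n f) q² ⟩
    Q n f S.- q² S.+ q²               ≈⟨ S.+-congʳ (S.trans (S.sym (FEqLHS≋ n f)) (S.trans h (-q²≋ds n))) ⟩
    S.- q² S.+ q²                     ≈⟨ S.-‿inverseˡ q² ⟩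
    S.0#                              ∎
    where
    open ≋-Reasoning
    open IntegerCoefficientSolver seriesRing
    q² = ᾱ (suc n) ⊛ ᾱ (suc n)

  root⇒FEq : ∀ n f → Q n f ≋ S.0# → FEqLHS n f ≋ const (ds n)
  root⇒FEq n f h = S.trans (FEqLHS≋ n f) (S.trans (S.+-congʳ h) (S.trans (S.+-identityˡ _) (S.sym (-q²≋ds n))))

  -- Self-similarity of the fraction: by the periodicity of `u` and the shift rule of `v`, skipping
  -- two levels is the same as starting afresh at n + 1.
  tail-shift : ∀ n m i → tail u (v n) m (suc (suc i)) ≡ tail u (v (suc n)) m i
  tail-shift n zero    i = ≡.trans (tail-zero _ _ _) (≡.sym (tail-zero _ _ _))
  tail-shift n (suc m) i = begin
    tail u (v n) (suc m) (suc (suc i))                                   ≡⟨ tail-suc _ _ _ _ ⟩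
    level (u (suc (suc (suc i)))) (v n (suc (suc (suc i)))) (tail u (v n) m (suc (suc (suc i))))
      ≡⟨ ≡.cong₂ (λ a b → level a b (tail u (v n) m (suc (suc (suc i))))) (u-period i) (v-shift n i) ⟩
    level (u (suc i)) (v (suc n) (suc i)) (tail u (v n) m (suc (suc (suc i))))
      ≡⟨ ≡.cong (level _ _) (tail-shift n m (suc i)) ⟩
    level (u (suc i)) (v (suc n) (suc i)) (tail u (v (suc n)) m (suc i)) ≡⟨ tail-suc _ _ _ _ ⟨
    tail u (v (suc n)) (suc m) i                                         ∎
    where
    open ≡.≡-Reasoning
    level : C → C → (ℕ → C) → (ℕ → C)
    level a b t = invₛ ((1ₛ +ₛ (a ·ₛ xₛ)) -ₛ (b ·ₛ ((xₛ *ₛ xₛ) *ₛ t)))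

  tail-inverse : ∀ u v m i → tail u v (suc m) i ⊛
    (S.1# S.+ const (u (suc i)) ⊛ xₛ S.- const (v (suc i)) ⊛ (xₛ ⊛ xₛ ⊛ tail u v m (suc i))) ≋ S.1#
  tail-inverse u v m i = begin
    tail u v (suc m) i ⊛ D′    ≡⟨ ≡.cong (_⊛ D′) (tail-suc u v m i) ⟩
    invₛ D ⊛ D′              ≈⟨ S.*-congˡ {invₛ D} D≋D′ ⟨
    invₛ D ⊛ D               ≈⟨ S.*-comm (invₛ D) D ⟩
    D ⊛ invₛ D               ≈⟨ invₛ-inverse D (monic≉0 (S.trans D≋D′ expand) (1+cX+gX² _ _)) ⟩
    S.1#                     ∎
    where
    open ≋-Reasoning
    open IntegerCoefficientSolver seriesRing
    D = (1ₛ +ₛ (u (suc i) ·ₛ xₛ)) -ₛ (v (suc i) ·ₛ ((xₛ *ₛ xₛ) *ₛ tail u v m (suc i)))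
    D′ = S.1# S.+ const (u (suc i)) ⊛ xₛ S.- const (v (suc i)) ⊛ (xₛ ⊛ xₛ ⊛ tail u v m (suc i))
    D≋D′ : D ≋ D′
    D≋D′ = -ₛ-cong (+ₛ-cong 1ₛ≋1 (·ₛ-cong S.refl S.refl)) (·ₛ-cong S.refl S.refl)
    expand : D′ ≋ S.1# S.+ const (u (suc i)) ⊛ xₛ S.+ xₛ ⊛ (S.- (const (v (suc i)) ⊛ (xₛ ⊛ tail u v m (suc i))))
    expand = solve 4 (λ a b x t → con (+ 1) :+ a :* x :- b :* (x :* x :* t) := con (+ 1) :+ a :* x :+ x :* (:- (b :* (x :* t))))
      S.refl (const (u (suc i))) (const (v (suc i))) xₛ (tail u v m (suc i))

  T G : ℕ → ℕ → (ℕ → C)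
  T n m = tail u (v n) m 0
  G n m = tail u (v n) (suc m) 1

  v-one≈ : ∀ n → v n 1 R.≈ (α (suc (suc n)) R.* α⁻¹ n)
  v-one≈ n = R.trans (R.reflexive (≡.trans (v-one n) (div-def _ _))) (R.*-congʳ (αs≈ (suc n)))

  v-two≈ : ∀ n → v n 2 R.≈ (α (suc n) R.* α⁻¹ (suc n))
  v-two≈ n = R.trans (R.reflexive (≡.trans (v-two n) (div-def _ _))) (R.*-congʳ (αs≈ n))

  odd-level : ∀ n t → (S.1# S.- const s ⊛ xₛ S.- const (α (suc (suc n)) R.* α⁻¹ n) ⊛ t) ≋
    (S.1# S.+ const (u 1) ⊛ xₛ S.- const (v n 1) ⊛ t)
  odd-level n t = S.sym (S.+-cong (S.+-congˡ (S.trans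
      (S.*-congʳ (S.trans (const-cong (R.reflexive u-one)) (const-neg s))) (S.sym (-‿distribˡ-* _ _))))
    (S.-‿cong (S.*-congʳ (const-cong (v-one≈ n)))))
    where open import Algebra.Properties.Ring S.ring using (-‿distribˡ-*)

  even-level : ∀ n t → (S.1# S.- const (α (suc n) R.* α⁻¹ (suc n)) ⊛ t) ≋
    (S.1# S.+ const (u 2) ⊛ xₛ S.- const (v n 2) ⊛ t)
  even-level n t = S.+-cong (S.sym (S.trans (S.+-congˡ (λ k → R.trans (const-⊛ (u 2) xₛ k)
      (R.trans (R.*-congʳ (R.reflexive u-two)) (R.zeroˡ _)))) (S.+-identityʳ _)))
    (S.-‿cong (S.*-congʳ (const-cong (R.sym (v-two≈ n)))))

  isConvergents : IsConvergents T
  isConvergents = record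
    { G = G
    ; T-zero = λ n → S.trans (S.reflexive (tail-zero u (v n) 0)) 1ₛ≋1
    ; T-one = λ n → S.trans (S.*-congˡ {T n 1} (S.trans (odd-level n (xₛ ⊛ xₛ))
        (S.+-congˡ (S.-‿cong (S.*-congˡ {const (v n 1)} (S.sym (S.trans (S.*-congˡ {xₛ ⊛ xₛ} (S.trans (S.reflexive (tail-zero u (v n) 1)) 1ₛ≋1)) (S.*-identityʳ (xₛ ⊛ xₛ)))))))))
        (tail-inverse u (v n) 0 0)
    ; T-suc = λ n m → S.trans (S.*-congˡ {T n (suc (suc m))} (odd-level n (xₛ ⊛ xₛ ⊛ G n m))) (tail-inverse u (v n) (suc m) 0)
    ; G-def = λ n m → S.trans (S.*-congˡ {G n m} (S.trans (even-level n (xₛ ⊛ xₛ ⊛ T (suc n) m))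
        (S.+-congˡ (S.-‿cong (S.*-congˡ {const (v n 2)} (S.*-congˡ {xₛ ⊛ xₛ} (S.reflexive (≡.sym (tail-shift n m 0)))))))))
        (tail-inverse u (v n) m 1) }

  jFrac≈T : ∀ n k → jFrac u (v n) k R.≈ T n k k
  jFrac≈T n k = R.trans (R.reflexive (jFrac-def u (v n) k)) (R.trans (R.*-congʳ (R.reflexive (v-zero n))) (R.*-identityˡ _))

  jFrac-isRoot : ∀ n → Q n (jFrac u (v n)) ≋ S.0#
  jFrac-isRoot n = limit-isRoot isConvergents n (jFrac≈T n)

  theorem : ∀ n → (jFrac u (v n) 0 ≈ 1# × (∀ k → FEqLHS n (jFrac u (v n)) k ≈ const (ds n) k))
    × ((f : ℕ → C) → f 0 ≈ 1# → (∀ k → FEqLHS n f k ≈ const (ds n) k) → ∀ k → f k ≈ jFrac u (v n) k)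
  theorem n =
    ( R.trans (jFrac≈T n 0) (R.trans (IsConvergents.T-zero isConvergents n 0) (R.reflexive (const-zero 1#)))
    , root⇒FEq n (jFrac u (v n)) (jFrac-isRoot n))
    , λ f _ h → root-unique n (FEq⇒root n f h) (jFrac-isRoot n)

-- The coefficient field

module _ {c ℓ} {C : Set c} {_≈_ : C → C → Set ℓ} {_+_ _*_ : C → C → C} { -_ : C → C} {0# 1# : C}
  (isCR : IsCommutativeRing _≈_ _+_ _*_ -_ 0# 1#) where

  -- The cancellation in one coefficient of f times its inverse. It is stated for variable
  -- operations, so that the solver does not meet the arithmetic of `K`.
  inverse-cancel : ∀ a i t → (a * i) ≈ 1# → ((a * (- (i * t))) + t) ≈ 0#
  inverse-cancel a i t ai≈1 = begin
    a R.* (R.- (i R.* t)) R.+ t ≈⟨ solve 3 (λ a i t → a :* (:- (i :* t)) :+ t := t :- a :* i :* t) R.refl a i t ⟩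
    t R.- a R.* i R.* t            ≈⟨ R.+-congˡ (R.-‿cong (R.*-congʳ ai≈1)) ⟩
    t R.- 1# R.* t               ≈⟨ solve 1 (λ t → t :- con (+ 1) :* t := con (+ 0)) R.refl t ⟩
    0#                         ∎
    where
    R : CommutativeRing _ _
    R = record { isCommutativeRing = isCR }
    module R = CommutativeRing R
    open IntegerCoefficientSolver R
    open Relation.Binary.Reasoning.Setoid R.setoid
    

private module KR = IsCommutativeRing kIsCommutativeRing

-- `invVec` stores the coefficients of the inverse in descending order, so that pairing it with an
-- ascending list produces the terms of a convolution.
zipWith-invVec : ∀ f k (g : Fin (suc k) → K) →
  zipWith _*K_ (tabulate g) (invVec f k) ≡ tabulate (λ i → g i *K invS f (k ℕ.∸ toℕ i))
zipWith-invVec f zero    g = ≡.refl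
zipWith-invVec f (suc k) g = ≡.cong (g Fin.zero *K invS f (suc k) ∷_) (zipWith-invVec f k (g ∘ Fin.suc))

invS-suc : ∀ f k → invS f (suc k) ≡ (-K (invK (f 0) *K ((f ∘ suc) *S invS f) k))
invS-suc f k = ≡.cong (λ v → -K (invK (f 0) *K sumV v)) (zipWith-invVec f k (λ i → f (suc (toℕ i))))

invS-inverse : ∀ f → ¬ f 0 ≈K 0K → ∀ k → (f *S invS f) k ≈K constS 1K k
invS-inverse f f₀≉0 zero    = KR.trans {(f *S invS f) 0} {f 0 *K invK (f 0)} {1K}
  (KR.+-identityʳ (f 0 *K invK (f 0))) (*K-inverseʳ (f 0) f₀≉0)
-- The product at `suc k` unfolds to `f 0` times the newest coefficient plus the convolution of the
-- rest, and the recursion of `invS` is designed to cancel that sum.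
invS-inverse f f₀≉0 (suc k) = ≡.subst (λ g → (f 0 *K g) +K ((f ∘ suc) *S invS f) k ≈K 0K) (≡.sym (invS-suc f k))
  (inverse-cancel kIsCommutativeRing (f 0) (invK (f 0)) (((f ∘ suc) *S invS f) k) (*K-inverseʳ (f 0) f₀≉0))

point : ℕ → ℚ
point 0 = ℚ.- 1ℚ
point 1 = ℚ.- (1ℚ ℚ.+ 1ℚ)
point _ = 0ℚ

open Evaluation point
open Fractions fractionOperations using (Represents; rep; rep-⊞; rep-⊠; rep-⊟; rep-oneF; represents-zeroF)

-- The value at s = 0, y = -2, z = -1.
record HasValue (x : K) (w : ℚ) : Set where
  constructor hasValue
  field
    {p q}      : P3
    fraction   : Represents x p q
    evalP-num  : evalP 3 p ≡ w
    evalP-den  : evalP 3 q ≡ 1ℚ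

hasValue-+ : ∀ {x y v w} → HasValue x v → HasValue y w → HasValue (x +K y) (v ℚ.+ w)
hasValue-+ {x} {y} {v} {w} (hasValue {p} {q} fx ep eq) (hasValue {p′} {q′} fy ep′ eq′) = hasValue (rep-⊞ {x} {y} fx fy)
  (begin
    evalP 3 (addP 3 (mulP 3 p q′) (mulP 3 p′ q))             ≡⟨ evalP-+ 3 (mulP 3 p q′) (mulP 3 p′ q) ⟩
    evalP 3 (mulP 3 p q′) ℚ.+ evalP 3 (mulP 3 p′ q)          ≡⟨ ≡.cong₂ ℚ._+_ (evalP-* 3 p q′) (evalP-* 3 p′ q) ⟩
    evalP 3 p ℚ.* evalP 3 q′ ℚ.+ evalP 3 p′ ℚ.* evalP 3 q    ≡⟨ ≡.cong₂ ℚ._+_ (≡.cong₂ ℚ._*_ ep eq′) (≡.cong₂ ℚ._*_ ep′ eq) ⟩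
    v ℚ.* 1ℚ ℚ.+ w ℚ.* 1ℚ                                    ≡⟨ ≡.cong₂ ℚ._+_ (ℚ.*-identityʳ v) (ℚ.*-identityʳ w) ⟩
    v ℚ.+ w                                                  ∎)
  (≡.trans (evalP-* 3 q q′) (≡.cong₂ ℚ._*_ eq eq′))
  where open ≡.≡-Reasoning

hasValue-* : ∀ {x y v w} → HasValue x v → HasValue y w → HasValue (x *K y) (v ℚ.* w)
hasValue-* {x} {y} (hasValue {p} {q} fx ep eq) (hasValue {p′} {q′} fy ep′ eq′) = hasValue (rep-⊠ {x} {y} fx fy)
  (≡.trans (evalP-* 3 p p′) (≡.cong₂ ℚ._*_ ep ep′))
  (≡.trans (evalP-* 3 q q′) (≡.cong₂ ℚ._*_ eq eq′))

hasValue-neg : ∀ {x w} → HasValue x w → HasValue (-K x) (ℚ.- w)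
hasValue-neg {x} (hasValue {p} fx ep eq) = hasValue (rep-⊟ {x} fx) (≡.trans (evalP-neg 3 p) (≡.cong ℚ.-_ ep)) eq

hasValue≉0 : ∀ {x w} → ¬ w ≡ 0ℚ → HasValue x w → ¬ x ≈K 0K
hasValue≉0 {x} w≢0 (hasValue {p} fx ep _) x≈0 =
  w≢0 (≡.trans (≡.sym ep) (evalP-zero 3 (EqP⇒IsZeroP 3 {p} (represents-zeroF {x} fx x≈0))))

αK : ℕ → K
αK = shiftedα _+K_ _*K_ -K_ 1K yK zK

-- Two consecutive values are carried along, as the recurrence has order two; -(-2 · 1) + (-1)
-- evaluates to `1ℚ` by computation.
αK-value : ∀ n → HasValue (αK n) 1ℚ × HasValue (αK (suc n)) 1ℚ
αK-value zero = hasValue-neg {zK} (hasValue {zK} (rep zK) ≡.refl ≡.refl) , hasValue rep-oneF ≡.refl ≡.refl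
αK-value (suc n) = proj₂ (αK-value n) ,
  hasValue-+ { -K (yK *K αK (suc n))} { -K αK n}
    (hasValue-neg {yK *K αK (suc n)} (hasValue-* {yK} {αK (suc n)} (hasValue (rep yK) ≡.refl ≡.refl) (proj₂ (αK-value n))))
    (hasValue-neg {αK n} (proj₁ (αK-value n)))

αK≉0 : ∀ n → ¬ αK (suc n) ≈K 0K
αK≉0 n = hasValue≉0 {αK (suc n)} (λ ()) (proj₂ (αK-value n))

kSetting : Setting
kSetting = record
  { R = kRing
  ; _-_ = _-K_ ; _/_ = _/K_ ; inv = invK
  ; sub-def = λ _ _ → ≡.refl ; div-def = λ _ _ → ≡.refl ; inv-inverse = *K-inverseʳ
  ; _+ₛ_ = _+S_ ; _-ₛ_ = _-S_ ; _*ₛ_ = _*S_ ; _/ₛ_ = _/S_ ; _·ₛ_ = _·S_ ; const = constS ; invₛ = invS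
  ; +ₛ-def = λ _ _ _ → ≡.refl ; -ₛ-def = λ _ _ _ → ≡.refl
  ; *ₛ-zero = λ _ _ → ≡.refl ; *ₛ-suc = λ _ _ _ → ≡.refl
  ; /ₛ-def = λ _ _ → ≡.refl ; ·ₛ-def = λ _ _ _ → ≡.refl
  ; const-zero = λ _ → ≡.refl ; const-suc = λ _ _ → ≡.refl
  ; invₛ-inverse = invS-inverse
  ; 1ₛ = 1S ; xₛ = xS ; x2 = x² ; x3 = x³ ; x4 = x⁴
  ; 1ₛ-def = ≡.refl ; xₛ-zero = ≡.refl ; xₛ-one = ≡.refl ; xₛ-suc = λ _ → ≡.refl
  ; x2-def = ≡.refl ; x3-def = ≡.refl ; x4-def = ≡.refl
  ; s = sK ; y = yK ; z = zK ; two = 2K ; y²-two = y²-2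
  ; two-def = ≡.refl ; y²-two-def = ≡.refl
  ; α≉0 = αK≉0
  ; quad = quadS ; den = denS ; as = aS ; bs = bS ; ds = dS ; αs = αS
  ; quad-def = ≡.refl ; den-def = ≡.refl ; as-def = ≡.refl ; bs-def = ≡.refl ; ds-def = ≡.refl ; αs-def = ≡.refl
  ; u = uSeq ; v = vSeq
  ; u-one = ≡.refl ; u-two = ≡.refl ; u-period = λ _ → ≡.refl
  ; v-zero = λ _ → ≡.refl ; v-one = λ _ → ≡.refl ; v-two = λ _ → ≡.refl ; v-shift = λ _ _ → ≡.refl
  ; tail = JT ; jFrac = JFrac
  ; tail-zero = λ _ _ _ → ≡.refl ; tail-suc = λ _ _ _ _ → ≡.refl ; jFrac-def = λ _ _ _ → ≡.refl
  }

-- With the operations as variables, instantiating them yields the statement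
-- literally, so that no arithmetic of K is unfolded to compare the two.
restated : (N : Setting) → let open Setting N in
  {_≈′_ : C → C → Set} {_-′_ _*′_ : C → C → C} {1′ s′ y′ two′ : C}
  {_+″_ _-″_ _*″_ : (ℕ → C) → (ℕ → C) → (ℕ → C)} {_·″_ : C → (ℕ → C) → (ℕ → C)} {const′ : C → ℕ → C}
  {x₁ x₂ x₃ x₄ as′ bs′ ds′ : ℕ → C} {F : ℕ → ℕ → C} →
  _≈_ ≡ _≈′_ → _-_ ≡ _-′_ → _*_ ≡ _*′_ → 1# ≡ 1′ → s ≡ s′ → y ≡ y′ → two ≡ two′ →
  _+ₛ_ ≡ _+″_ → _-ₛ_ ≡ _-″_ → _*ₛ_ ≡ _*″_ → _·ₛ_ ≡ _·″_ → const ≡ const′ →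
  xₛ ≡ x₁ → x2 ≡ x₂ → x3 ≡ x₃ → x4 ≡ x₄ → as ≡ as′ → bs ≡ bs′ → ds ≡ ds′ → (λ n → jFrac u (v n)) ≡ F →
  let IsSolution : ℕ → (ℕ → C) → Set
      IsSolution n f = ∀ k →
        ((((((as′ n ·″ x₄) -″ ((s′ *′ bs′ n) ·″ x₃)) +″ (bs′ n ·″ x₂)) *″ f) *″ f)
          +″ ((((((y′ *′ ds′ n) -′ (two′ *′ bs′ n)) ·″ x₂) -″ ((s′ *′ ds′ n) ·″ x₁)) +″ const′ (ds′ n)) *″ f)) k
        ≈′ const′ (ds′ n) k
  in ∀ n → ((F n 0 ≈′ 1′) × IsSolution n (F n)) × ((f : ℕ → C) → f 0 ≈′ 1′ → IsSolution n f → ∀ k → f k ≈′ F n k)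
restated N ≡.refl ≡.refl ≡.refl ≡.refl ≡.refl ≡.refl ≡.refl ≡.refl ≡.refl ≡.refl ≡.refl ≡.refl ≡.refl ≡.refl
  ≡.refl ≡.refl ≡.refl ≡.refl ≡.refl ≡.refl = JFractionTheorem.theorem N

theorem3p4 : (n : ℕ) →
    ((JFrac uSeq (vSeq n) 0 ≈K 1K) × FEq n (JFrac uSeq (vSeq n)))
    × ((f : Series) → f 0 ≈K 1K → FEq n f → f ≈S JFrac uSeq (vSeq n))
theorem3p4 = restated kSetting {_≈K_} {_-K_} {_*K_} {1K} {sK} {yK} {2K} {_+S_} {_-S_} {_*S_} {_·S_} {constS}
  {xS} {x²} {x³} {x⁴} {aS} {bS} {dS} {λ n → JFrac uSeq (vSeq n)}
  ≡.refl ≡.refl ≡.refl ≡.refl ≡.refl ≡.refl ≡.refl ≡.refl ≡.refl ≡.refl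
  ≡.refl ≡.refl ≡.refl ≡.refl ≡.refl ≡.refl ≡.refl ≡.refl ≡.refl ≡.refl
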